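{- If $G$ is a 2-connected $K_{1,4}$-heavy graph, and $C$ is a longest cycle of $G$, then $C$ is a heavy cycle of $G$.
   Context: All graphs are finite and simple. Let $G$ be a graph on $n$ vertices. A vertex $v$ of $G$ is called heavy if its degree satisfies $d(v)\geq n/2$. A cycle $C$ of $G$ is called heavy if $C$ contains all heavy vertices of $G$. For a given graph $H$, the graph $G$ is called $H$-heavy if every induced subgraph of $G$ isomorphic to $H$ contains two vertices that are nonadjacent and whose degrees in $G$ have sum at least $n$. (In particular, a graph with no induced subgraph isomorphic to $H$ is $H$-heavy.) $K_{1,4}$ denotes the star with four leaves. -}

module Defs where

open import Data.Fin using (Fin; zero; suc)
open import Data.Fin.Subset using (Subset; _∈_; _∉_; ∣_∣)
open import Data.List using (List; _∷_; length; _∷ʳ_)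
import Data.List.Membership.Propositional as List
open import Data.List.Relation.Unary.Linked using (Linked)
open import Data.List.Relation.Unary.Unique.Propositional using (Unique)
open import Data.Nat using (ℕ; suc; _+_; _*_; _≤_; _<_)
open import Data.Product using (_×_; ∃; ∃₂)
open import Data.Vec using (tabulate)
open import Function.Bundles using (_⇔_)
open import Function.Definitions using (Injective)
open import Relation.Binary.Construct.Closure.ReflexiveTransitive using (Star)
open import Relation.Binary.Definitions using (Decidable; Irreflexive; Symmetric)
open import Relation.Binary.PropositionalEquality using (_≡_; _≢_)
open import Relation.Nullary using (¬_; does; yes; no)

record Graph (n : ℕ) : Set₁ where
  field
    Adj        : Fin n → Fin n → Set
    adj?       : Decidable Adj
    adj-sym    : Symmetric Adj
    adj-irrefl : Irreflexive _≡_ Adj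

  neighbours : Fin n → Subset n
  neighbours v = tabulate (λ u → does (adj? v u))

  degree : Fin n → ℕ
  degree v = ∣ neighbours v ∣

  -- degree v ≥ n/2 with n/2 rational, cleared of its denominator.
  Heavy : Fin n → Set
  Heavy v = n ≤ 2 * degree v

  AdjAvoiding : Subset n → Fin n → Fin n → Set
  AdjAvoiding X u v = Adj u v × u ∉ X × v ∉ X

  -- G − X is connected.
  ConnectedWithout : Subset n → Set
  ConnectedWithout X = ∀ {u v} → u ∉ X → v ∉ X → Star (AdjAvoiding X) u v

-- More than k vertices, and no set of fewer than k vertices disconnects G.
_-Connected_ : ∀ {n} → ℕ → Graph n → Set
_-Connected_ {n} k G =
  k < n × (∀ (X : Subset n) → ∣ X ∣ < k → Graph.ConnectedWithout G X)

-- The closing edge is included by repeating `start` at the end of the list in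
-- `linked`.
record Cycle {n} (G : Graph n) : Set where
  open Graph G
  field
    start : Fin n
    rest  : List (Fin n)

  vertices : List (Fin n)
  vertices = start ∷ rest

  field
    unique   : Unique vertices
    linked   : Linked Adj (vertices ∷ʳ start)
    3≤length : 3 ≤ length vertices

module _ {n} {G : Graph n} where

  open Cycle

  cycleLength : Cycle G → ℕ
  cycleLength C = length (vertices C)

  Longest : Cycle G → Set
  Longest C = ∀ (C′ : Cycle G) → cycleLength C′ ≤ cycleLength C

  HeavyCycle : Cycle G → Set
  HeavyCycle C = ∀ v → Graph.Heavy G v → v List.∈ vertices C

-- An isomorphism from H onto the subgraph of G induced by S.
record InducedIso {m n} (H : Graph m) (G : Graph n) (S : Subset n) : Set where
  field
    to        : Fin m → Fin n
    injective : Injective _≡_ _≡_ to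
    image     : ∀ v → v ∈ S ⇔ ∃ (λ i → to i ≡ v)
    adjacency : ∀ i j → Graph.Adj H i j ⇔ Graph.Adj G (to i) (to j)

-- G is H-heavy; degrees are taken in G, not in the induced subgraph.
_-Heavy_ : ∀ {m n} → Graph m → Graph n → Set
_-Heavy_ {n = n} H G =
  ∀ (S : Subset n) → InducedIso H G S →
  ∃₂ λ u v → u ∈ S × v ∈ S × u ≢ v × ¬ Adj u v × n ≤ degree u + degree v
  where open Graph G

data StarAdj {k} : Fin (suc k) → Fin (suc k) → Set where
  centre-leaf : ∀ i → StarAdj zero (suc i)
  leaf-centre : ∀ i → StarAdj (suc i) zero

starAdj? : ∀ {k} → Decidable (StarAdj {k})
starAdj? zero    zero    = no λ ()
starAdj? zero    (suc i) = yes (centre-leaf i)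
starAdj? (suc i) zero    = yes (leaf-centre i)
starAdj? (suc i) (suc j) = no λ ()

starAdj-sym : ∀ {k} → Symmetric (StarAdj {k})
starAdj-sym (centre-leaf i) = leaf-centre i
starAdj-sym (leaf-centre i) = centre-leaf i

starAdj-irrefl : ∀ {k} → Irreflexive _≡_ (StarAdj {k})
starAdj-irrefl () (centre-leaf i)
starAdj-irrefl () (leaf-centre i)

K₁,_ : (k : ℕ) → Graph (suc k)
K₁, k = record
  { Adj        = StarAdj
  ; adj?       = starAdj?
  ; adj-sym    = starAdj-sym
  ; adj-irrefl = starAdj-irrefl
  }

{-# OPTIONS --safe #-}
module Submission where

-- Suppose x is heavy and off the longest cycle C. Join by an edge all pairs of vertices other than x
-- whose degree sum is at least n. By the argument of Ore and Bondy–Chvátal C remains longest, and by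
-- K₁,₄-heaviness x has no four independent neighbours in the enlarged graph. Take a longest ear through x,
-- that is, a path with r interior vertices attached to C at two vertices only. As C is longest,
-- each arc of C between the ends of the ear contains at most half as many neighbours of x as its
-- length exceeds r, and counting the heavy degree of x gives a set S of at least r neighbours of x off C
-- and off the ear. Now take a longest path from x through such outer vertices back to C or the ear,
-- with t interior vertices. Neither the predecessor p nor the successor q of x on the ear has a
-- neighbour in S, and the part of S missed by the exit path is a clique (empty unless p and q are adjacent)
-- with at most t members. So |S| ≤ 2t, and |S| ≤ t unless p and q are adjacent. Rerouting the ear
-- through the exit path then makes it longer, unless the exit path ends on the ear, p and q are adjacent,
-- and t vertices of the ear are not adjacent to x. But then the count improves to |S| ≥ r + 2t.

import Algebra.Solver.CommutativeMonoid as CommutativeMonoidSolver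
open import Data.Empty using (⊥; ⊥-elim)
open import Data.Fin using (Fin; zero; suc; _≟_)
open import Data.Fin.Properties using (any?)
import Data.Fin.Subset as Subset
open import Data.Fin.Subset using (⁅_⁆)
open import Data.Fin.Subset.Properties using (∣⁅x⁆∣≡1; x≢y⇒x∉⁅y⁆; x∉⁅y⁆⇒x≢y)
import Data.List as List
open import Data.List
  using (List; []; _∷_; [_]; _++_; _∷ʳ_; length; lookup; reverse; filter; allFin)
open import Data.List.Membership.Propositional using (_∈_; _∉_)
open import Data.List.Membership.Propositional.Properties
  using (∈-∃++; ∈-++⁺ˡ; ∈-++⁺ʳ; ∈-++⁻; ∈-allFin; ∈-filter⁺; ∈-filter⁻; ∈-lookup)
open import Data.List.Membership.Propositional.Properties.WithK using (unique∧set⇒bag)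
open import Data.List.Properties
  using (length-++; length-filter; length-reverse; length-tabulate; filter-++; filter-reject;
         filter-≐; unfold-reverse; reverse-++; ++-assoc)
open import Data.List.Relation.Binary.BagAndSetEquality using (∼bag⇒↭)
open import Data.List.Relation.Binary.Permutation.Propositional
  using (_↭_; ↭-refl; ↭-sym; ↭-trans; ↭-reflexive; ↭⇒↭ₛ; prep)
open import Data.List.Relation.Binary.Permutation.Propositional.Properties
  using (↭-length; ↭-reverse; filter-↭; ∈-resp-↭; ++-commutativeMonoid; ++⁺ˡ; ++⁺ʳ; shift)
  renaming (++⁺ to ↭-++⁺)
import Data.List.Relation.Binary.Permutation.Setoid.Properties as Permutationₛ
open import Data.List.Relation.Unary.All using (All; []; _∷_)
import Data.List.Relation.Unary.All as All
open import Data.List.Relation.Unary.All.Properties using (¬Any⇒All¬)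
open import Data.List.Relation.Unary.AllPairs using (AllPairs; []; _∷_)
import Data.List.Relation.Unary.AllPairs as AllPairs
open import Data.List.Relation.Unary.Any using (here; there)
open import Data.List.Relation.Unary.Linked using (Linked; []; [-]; _∷_)
open import Data.List.Relation.Unary.Linked.Properties using (AllPairs⇒Linked)
open import Data.List.Relation.Unary.Unique.Propositional using (Unique)
open import Data.List.Relation.Unary.Unique.Propositional.Properties
  using (allFin⁺; filter⁺; Unique[x∷xs]⇒x∉xs)
  renaming (++⁺ to unique-++⁺)
open import Data.Nat using (ℕ; zero; suc; pred; _+_; _*_; _≤_; _<_; z≤n; s≤s; _≤?_)
open import Data.Nat.Properties hiding (_≟_)
open import Data.Nat.Tactic.RingSolver using (solve-∀)
open import Data.Product using (_×_; _,_; ∃; ∃₂; proj₁; proj₂)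
open import Data.Sum using (_⊎_; inj₁; inj₂; [_,_]′)
import Data.Vec as Vec
open import Data.Vec.Properties using (lookup∘tabulate; lookup⇒[]=; []=⇒lookup)
open import Function using (_∘_; _⇔_; mk⇔; id; case_of_; Equivalence)
open import Relation.Binary.Construct.Closure.ReflexiveTransitive using (Star; ε; _◅_; gmap)
open import Relation.Binary.Definitions using (Symmetric)
open import Relation.Binary.PropositionalEquality
  using (_≡_; _≢_; refl; sym; trans; cong; cong₂; subst; ≢-sym; setoid)
open import Relation.Nullary using (¬_; yes; no; does; ¬?; _×-dec_; _⊎-dec_)
open import Relation.Nullary.Decidable using (dec-true)
open import Relation.Unary using (Decidable)

open import Defs

-- Maximality, and lists without repetition.

-- Constructive maximality: refuting every maximal element of X refutes X, without finding a maximum.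
ascent : ∀ {X : Set} (size : X → ℕ) {m} → (∀ x → size x ≤ m) →
         (∀ x → (∀ y → size y ≤ size x) → ⊥) → ¬ X
ascent {X} size {m} bound refute x₀ = go m x₀ (m≤n+m m _)
  where
  go : ∀ k (x : X) → m ≤ size x + k → ⊥
  go k x m≤ = refute x λ y → ≮⇒≥ λ x<y → climb k m≤ y x<y
    where
    climb : ∀ k → m ≤ size x + k → ∀ y → ¬ size x < size y
    climb zero m≤ y x<y =
      <⇒≱ x<y (≤-trans (bound y) (≤-trans m≤ (≤-reflexive (+-identityʳ _))))
    climb (suc k) m≤ y x<y =
      go k y (≤-trans m≤ (≤-trans (≤-reflexive (+-suc _ k)) (+-monoˡ-≤ k x<y)))

-- Linear arithmetic: l ≤ r is a sum of hypotheses, and k what it has in excess of the goal a ≤ b.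
cancel-≤ : ∀ {l r a b} k → l ≤ r → l ≡ k + a → r ≡ k + b → a ≤ b
cancel-≤ k l≤r refl refl = +-cancelˡ-≤ k _ _ l≤r

module _ {A : Set} where

  open CommutativeMonoidSolver (++-commutativeMonoid {A = A}) public
    using (_⊕_; _⊜_) renaming (solve to ↭-solve)

nonempty-∈ : ∀ {A : Set} {xs : List A} → 0 < length xs → ∃ (_∈ xs)
nonempty-∈ {xs = x ∷ _} _ = x , here refl

unique-↭ : ∀ {A : Set} {xs ys : List A} → xs ↭ ys → Unique xs → Unique ys
unique-↭ p = Permutationₛ.Unique-resp-↭ (setoid _) (↭⇒↭ₛ p)

unique-++⁻ˡ : ∀ {A : Set} (xs : List A) {ys} → Unique (xs ++ ys) → Unique xs
unique-++⁻ˡ []       _        = []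
unique-++⁻ˡ (x ∷ xs) (px ∷ u) = All.tabulate (All.lookup px ∘ ∈-++⁺ˡ) ∷ unique-++⁻ˡ xs u

unique-sub : ∀ {A : Set} {xs ys : List A} zs → ys ↭ xs ++ zs → Unique ys → Unique xs
unique-sub {xs = xs} zs p u = unique-++⁻ˡ xs (unique-↭ p u)

unique-∷ : ∀ {A : Set} {x : A} {xs} → x ∉ xs → Unique xs → Unique (x ∷ xs)
unique-∷ x∉ u = ¬Any⇒All¬ _ x∉ ∷ u

unique-++⁻-disjoint : ∀ {A : Set} xs {ys} {x : A} → Unique (xs ++ ys) → x ∈ xs → x ∉ ys
unique-++⁻-disjoint (x ∷ xs) (px ∷ u) (here refl) q = All.lookup px (∈-++⁺ʳ xs q) refl
unique-++⁻-disjoint (x ∷ xs) (px ∷ u) (there p)   q = unique-++⁻-disjoint xs u p q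

module _ {n : ℕ} where

  open import Data.List.Membership.DecPropositional (_≟_ {n}) public using (_∈?_; _∉?_)

  complement : List (Fin n) → List (Fin n)
  complement xs = filter (_∉? xs) (allFin n)

  allFin-↭ : ∀ {xs} → Unique xs → allFin n ↭ xs ++ complement xs
  allFin-↭ {xs} u = ∼bag⇒↭ (unique∧set⇒bag (allFin⁺ n) unique-both
    λ {v} → mk⇔ (λ _ → to v) λ _ → ∈-allFin v)
    where
    unique-both = unique-++⁺ u (filter⁺ (_∉? xs) (allFin⁺ n))
      λ (v∈xs , v∈c) → proj₂ (∈-filter⁻ (_∉? xs) {xs = allFin n} v∈c) v∈xs
    to : ∀ v → v ∈ xs ++ complement xs
    to v with v ∈? xs
    ... | yes v∈ = ∈-++⁺ˡ v∈
    ... | no  v∉ = ∈-++⁺ʳ xs (∈-filter⁺ (_∉? xs) (∈-allFin v) v∉)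

  length-allFin : length (allFin n) ≡ n
  length-allFin = length-tabulate id

  unique-length : ∀ {xs : List (Fin n)} → Unique xs → length xs + length (complement xs) ≡ n
  unique-length {xs} u = trans (sym (length-++ xs))
    (trans (sym (↭-length (allFin-↭ u))) length-allFin)

  unique-length-≤ : ∀ {xs : List (Fin n)} → Unique xs → length xs ≤ n
  unique-length-≤ {xs} u = ≤-trans (m≤m+n _ _) (≤-reflexive (unique-length u))

-- Counting list entries with a decidable property.

module Counting {A : Set} {P : A → Set} (P? : Decidable P) where

  count : List A → ℕ
  count = length ∘ filter P?

  count-++ : ∀ xs ys → count (xs ++ ys) ≡ count xs + count ys
  count-++ xs ys = trans (cong length (filter-++ P? xs ys)) (length-++ (filter P? xs))

  count-↭ : ∀ {xs ys} → xs ↭ ys → count xs ≡ count ys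
  count-↭ p = ↭-length (filter-↭ P? p)

  count-≤ : ∀ xs → count xs ≤ length xs
  count-≤ = length-filter P?

  count-∷-≤ : ∀ x xs → count (x ∷ xs) ≤ suc (count xs)
  count-∷-≤ x xs with P? x
  ... | yes _ = ≤-refl
  ... | no  _ = n≤1+n _

  count-reject : ∀ {x xs} → ¬ P x → count (x ∷ xs) ≡ count xs
  count-reject ¬Px = cong length (filter-reject P? ¬Px)

  count-delay : ∀ t xs → (∀ {ys z zs} → xs ≡ ys ++ z ∷ zs → P z → t ≤ length ys) →
                t ≤ length xs → count xs + t ≤ length xs
  count-delay zero    xs       _     _ = ≤-trans (≤-reflexive (+-identityʳ _)) (count-≤ xs)
  count-delay (suc t) (x ∷ xs) delay (s≤s t≤) = ≤-trans
    (≤-reflexive (trans (cong (_+ suc t) (count-reject λ Px → n≮0 (delay {[]} refl Px))) (+-suc _ t)))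
    (s≤s (count-delay t xs (λ { refl Pz → ≤-pred (delay refl Pz) }) t≤))

  Sparse : ℕ → ℕ → List A → Set
  Sparse s k xs = ∀ {ys z zs} → xs ≡ ys ++ z ∷ zs → P z →
    s ≤ length ys × k ≤ length zs × (∀ {z′ zs′} → zs ≡ z′ ∷ zs′ → ¬ P z′)

  -- If `c ≥ 1` entries satisfy `P`, no two of them consecutive, they span at least `2c - 1` places,
  -- and `s + k` further places lie outside that span; hence the `suc` on the right.
  count-sparse : ∀ s k xs → Sparse s k xs →
                 count xs ≡ 0 ⊎ 2 * count xs + (s + k) ≤ suc (length xs)
  count-sparse s       k []       _  = inj₁ refl
  count-sparse (suc s) k (x ∷ xs) sp
    with count-sparse s k xs (λ { refl Pz → let a , b , c = sp {x ∷ _} refl Pz in ≤-pred a , b , c })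
       | count-reject {x} {xs} (λ Px → n≮0 (proj₁ (sp {[]} refl Px)))
  ... | inj₁ none | eq = inj₁ (trans eq none)
  ... | inj₂ le   | eq rewrite eq = inj₂ (≤-trans (≤-reflexive (+-suc _ (s + k))) (s≤s le))
  count-sparse zero k (x ∷ xs) sp with P? x
  ... | no _ with count-sparse zero k xs (λ { refl Pz → let _ , b , c = sp {x ∷ _} refl Pz in z≤n , b , c })
  ...   | inj₁ none = inj₁ none
  ...   | inj₂ le   = inj₂ (m≤n⇒m≤1+n le)
  count-sparse zero k (x ∷ [])     sp | yes Px = inj₂ (+-monoʳ-≤ 2 (proj₁ (proj₂ (sp {[]} refl Px))))
  count-sparse zero k (x ∷ y ∷ xs) sp | yes Px
    with sp {[]} refl Px
  ... | _ , k≤ , ¬next rewrite count-reject {y} {xs} (¬next refl)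
    with count-sparse zero k xs (λ { refl Pz → let _ , b , c = sp {x ∷ y ∷ _} refl Pz in z≤n , b , c })
  ... | inj₁ none rewrite none = inj₂ (s≤s (s≤s k≤))
  ... | inj₂ le = inj₂ (≤-trans (≤-reflexive (lemma (count xs) k)) (s≤s (s≤s le)))
    where
    lemma : ∀ c k → 2 * suc c + k ≡ 2 + (2 * c + k)
    lemma = solve-∀

count-allFin : ∀ {n} {A : Set} {P : A → Set} (P? : Decidable P) (f : Fin n → A) →
  Subset.∣ Vec.tabulate (does ∘ P? ∘ f) ∣ ≡ Counting.count P? (List.tabulate f)
count-allFin {zero}  P? f = refl
count-allFin {suc n} P? f with P? (f zero)
... | yes _ = cong suc (count-allFin P? (f ∘ suc))
... | no  _ = count-allFin P? (f ∘ suc)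

-- Paths given by their interior vertices.

-- Distinctness is always stated separately by `Unique`, so a cycle is a `Path R u xs u` with
-- `Unique (u ∷ xs)`.
data Path {A : Set} (R : A → A → Set) : A → List A → A → Set where
  edge : ∀ {u v} → R u v → Path R u [] v
  _∷_  : ∀ {u v w xs} → R u w → Path R w xs v → Path R u (w ∷ xs) v

module _ {A : Set} {R : A → A → Set} where

  infixr 5 _▸_

  _▸_ : ∀ {u v w xs ys} → Path R u xs w → Path R w ys v → Path R u (xs ++ w ∷ ys) v
  edge e  ▸ q = e ∷ q
  (e ∷ p) ▸ q = e ∷ (p ▸ q)

  splitPath : ∀ {u v w} xs {ys} → Path R u (xs ++ w ∷ ys) v → Path R u xs w × Path R w ys v
  splitPath []       (e ∷ p) = edge e , p
  splitPath (x ∷ xs) (e ∷ p) = let q , r = splitPath xs p in e ∷ q , r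

  reversePath : Symmetric R → ∀ {u v xs} → Path R u xs v → Path R v (reverse xs) u
  reversePath R-sym (edge e) = edge (R-sym e)
  reversePath R-sym {u} {v} (_∷_ {w = w} {xs = xs} e p) = subst (λ ys → Path R v ys u)
    (sym (unfold-reverse w xs)) (reversePath R-sym p ▸ edge (R-sym e))

  -- `ys` runs up to and including `w`, and is empty if `w` is `u`, so one formula covers every path
  -- that turns off at `w`; `zs` is what such a path loses.
  redirect : ∀ {u v w xs} → Path R u xs v → w ∈ u ∷ xs →
    ∃₂ λ ys zs → xs ≡ ys ++ zs × Path R w zs v ×
    (∀ {ws z} → Path R w ws z → Path R u (ys ++ ws) z)
  redirect p       (here refl) = [] , _ , refl , p , id
  redirect (edge e) (there ())
  redirect (_∷_ {w = w} e p) (there w∈) =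
    let ys , zs , eq , q , f = redirect p w∈
    in  w ∷ ys , zs , cong (w ∷_) eq , q , (e ∷_) ∘ f

  lastEdge : ∀ {u v xs} → Path R u xs v → ∃ λ p → p ∈ u ∷ xs × R p v ×
    (∀ {ys z} → Path R p ys z → Path R u (xs ++ ys) z)
  lastEdge (edge e) = _ , here refl , e , id
  lastEdge (e ∷ p)  = let q , q∈ , f , g = lastEdge p in q , there q∈ , f , (e ∷_) ∘ g

  firstEdge : ∀ {u v xs} → Path R u xs v → ∃ λ q → q ∈ v ∷ xs × R u q ×
    (∀ {y} → R y q → Path R y xs v)
  firstEdge (edge e) = _ , here refl , e , edge
  firstEdge (e ∷ p)  = _ , there (here refl) , e , (_∷ p)

  linked⇒path : ∀ {u v} xs → Linked R (u ∷ xs ∷ʳ v) → Path R u xs v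
  linked⇒path []       (e ∷ _) = edge e
  linked⇒path (x ∷ xs) (e ∷ l) = e ∷ linked⇒path xs l

  path⇒linked : ∀ {u v xs} → Path R u xs v → Linked R (u ∷ xs ∷ʳ v)
  path⇒linked (edge e)                 = e ∷ [-]
  path⇒linked (e ∷ p) = e ∷ path⇒linked p

  lastVisit : ∀ {T : A → Set} → Decidable T → ∀ {u v xs} → T u → Path R u xs v →
    ∃₂ λ y ys → ∃ λ zs → T y × u ∷ xs ≡ zs ++ y ∷ ys × Path R y ys v × All (¬_ ∘ T) ys
  lastVisit {T} T? {u} Tu p with go p
    where
    go : ∀ {u v xs} → Path R u xs v → All (¬_ ∘ T) xs ⊎
      (∃₂ λ y ys → ∃ λ zs → T y × xs ≡ zs ++ y ∷ ys × Path R y ys v × All (¬_ ∘ T) ys)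
    go (edge e) = inj₁ []
    go (_∷_ {w = w} e p) with go p | T? w
    ... | inj₂ (y , ys , zs , Ty , refl , q , a) | _      = inj₂ (y , ys , w ∷ zs , Ty , refl , q , a)
    ... | inj₁ a                                 | yes Tw = inj₂ (w , _ , [] , Tw , refl , p , a)
    ... | inj₁ a                                 | no ¬Tw = inj₁ (¬Tw ∷ a)
  ... | inj₁ a = u , _ , [] , Tu , refl , p , a
  ... | inj₂ (y , ys , zs , Ty , refl , q , a) = y , ys , u ∷ zs , Ty , refl , q , a

mapPath : ∀ {A : Set} {R S : A → A → Set} → (∀ {u v} → R u v → S u v) →
          ∀ {u v xs} → Path R u xs v → Path S u xs v
mapPath f (edge e) = edge (f e)
mapPath f (e ∷ p)  = f e ∷ mapPath f p

module _ {A : Set} {P Q : A → Set} (P? : Decidable P) (Q? : Decidable Q) where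

  open Counting

  count-disjoint : ∀ xs → (∀ {z} → z ∈ xs → ¬ (P z × Q z)) →
                   count P? xs + count Q? xs ≤ length xs
  count-disjoint []       _ = z≤n
  count-disjoint (x ∷ xs) d with count-disjoint xs (d ∘ there) | P? x | Q? x
  ... | ih | yes Px | yes Qx = ⊥-elim (d (here refl) (Px , Qx))
  ... | ih | yes _  | no  _  = s≤s ih
  ... | ih | no  _  | yes _  = ≤-trans (≤-reflexive (+-suc _ _)) (s≤s ih)
  ... | ih | no  _  | no  _  = m≤n⇒m≤1+n ih

  -- Moved back by one place, `Q` becomes disjoint from `P`. Only the first entry of `Q` can get
  -- lost, which costs the extra one.
  count-noncrossing : ∀ xs → (∀ {ys y z zs} → xs ≡ ys ++ y ∷ z ∷ zs → ¬ (P y × Q z)) →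
                      count P? xs + count Q? xs ≤ suc (length xs)
  count-noncrossing []       _  = z≤n
  count-noncrossing (x ∷ xs) nc = ≤-trans (+-monoʳ-≤ (count P? (x ∷ xs)) (count-∷-≤ Q? x xs))
    (≤-trans (≤-reflexive (+-suc _ _)) (s≤s (shifted x xs nc)))
    where
    shifted : ∀ x xs → (∀ {ys y z zs} → x ∷ xs ≡ ys ++ y ∷ z ∷ zs → ¬ (P y × Q z)) →
              count P? (x ∷ xs) + count Q? xs ≤ suc (length xs)
    shifted x [] _ = ≤-trans (≤-reflexive (+-identityʳ _)) (count-≤ P? (x ∷ []))
    shifted x (y ∷ xs) nc
      with shifted y xs (λ {ys} eq → nc {x ∷ ys} (cong (x ∷_) eq)) | nc {[]} refl | P? x | Q? y
    ... | ih | no-xy | yes Px | yes Qy = ⊥-elim (no-xy (Px , Qy))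
    ... | ih | no-xy | yes _  | no  _  = s≤s ih
    ... | ih | no-xy | no  _  | yes _  = ≤-trans (≤-reflexive (+-suc _ _)) (s≤s ih)
    ... | ih | no-xy | no  _  | no  _  = m≤n⇒m≤1+n ih

-- Degrees, and Ore's exchange argument for cycles.

module _ {n} (G : Graph n) where

  open Graph G
  open Counting

  degree-count : ∀ v → degree v ≡ count (adj? v) (allFin n)
  degree-count v = count-allFin (adj? v) id

  degree-split : ∀ v {xs} → Unique xs →
                 degree v ≡ count (adj? v) xs + count (adj? v) (complement xs)
  degree-split v {xs} u = trans (degree-count v)
    (trans (count-↭ (adj? v) (allFin-↭ u)) (count-++ (adj? v) xs _))

-- The number of non-edges of an R-cycle can be decreased without shortening it: at a non-edge ab,
-- either a common neighbour off the cycle is inserted, or the degree sum forces a crossing pair.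
module OreCycle {n} (G : Graph n) (R : Fin n → Fin n → Set) (R-sym : Symmetric R)
  (Adj⇒R : ∀ {u v} → Graph.Adj G u v → R u v)
  (R⇒Ore : ∀ {u v} → R u v → Graph.Adj G u v ⊎ n ≤ Graph.degree G u + Graph.degree G v)
  where

  open Graph G
  open Counting

  cost : Fin n → Fin n → ℕ
  cost u v with adj? u v
  ... | yes _ = 0
  ... | no  _ = 1

  cost-edge : ∀ {u v} → Adj u v → cost u v ≡ 0
  cost-edge {u} {v} uv with adj? u v
  ... | yes _  = refl
  ... | no ¬uv = ⊥-elim (¬uv uv)

  cost-sym : ∀ u v → cost u v ≡ cost v u
  cost-sym u v with adj? u v | adj? v u
  ... | yes _  | yes _  = refl
  ... | yes uv | no ¬vu = ⊥-elim (¬vu (adj-sym uv))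
  ... | no ¬uv | yes vu = ⊥-elim (¬uv (adj-sym vu))
  ... | no _   | no _   = refl

  nonEdges : Fin n → List (Fin n) → Fin n → ℕ
  nonEdges u []       v = cost u v
  nonEdges u (w ∷ xs) v = cost u w + nonEdges w xs v

  nonEdges-++ : ∀ u xs w ys v → nonEdges u (xs ++ w ∷ ys) v ≡ nonEdges u xs w + nonEdges w ys v
  nonEdges-++ u []       w ys v = refl
  nonEdges-++ u (x ∷ xs) w ys v =
    trans (cong (cost u x +_) (nonEdges-++ x xs w ys v)) (sym (+-assoc (cost u x) _ _))

  nonEdges-reverse : ∀ u xs v → nonEdges v (reverse xs) u ≡ nonEdges u xs v
  nonEdges-reverse u []       v = cost-sym v u
  nonEdges-reverse u (x ∷ xs) v rewrite unfold-reverse x xs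
    | nonEdges-++ v (reverse xs) x [] u | nonEdges-reverse x xs v | cost-sym x u = +-comm _ (cost u x)

  noNonEdges : ∀ {u xs v} → Path R u xs v → nonEdges u xs v ≡ 0 → Path Adj u xs v
  noNonEdges {u} {v = v} (edge _) eq with adj? u v
  ... | yes uv = edge uv
  noNonEdges {u} (_∷_ {w = w} _ p) eq with adj? u w
  ... | yes uw = uw ∷ noNonEdges p eq

  -- A cycle on `vs` cut open at a non-edge `ab`. The path from `b` round to `a` omits that pair, so
  -- it has fewer non-edges than the whole cycle, whose number is `m`.
  record NonEdge (vs : List (Fin n)) (m : ℕ) : Set where
    field
      {a b}   : Fin n
      {zs}    : List (Fin n)
      nonAdj  : ¬ Adj a b
      related : R a b
      path    : Path R b zs a
      perm    : vs ↭ a ∷ b ∷ zs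
      fewer   : nonEdges b zs a < m

  -- As long as the first pair is an edge, it is moved to the end of the second path. This rotates
  -- the cycle until a non-edge comes to the front.
  findNonEdge : ∀ {u v xs ys} → Path R u xs v → Path R v ys u → 0 < nonEdges u xs v →
                NonEdge (u ∷ xs ++ v ∷ ys) (nonEdges u xs v + nonEdges v ys u)
  findNonEdge {u} {v} (edge e) q 0< with adj? u v
  ... | no ¬uv = record { nonAdj = ¬uv ; related = e ; path = q ; perm = ↭-refl ; fewer = ≤-refl }
  findNonEdge {u} {v} {w ∷ xs} {ys} (e ∷ p) q 0< with adj? u w in eq
  ... | no ¬uw = record { nonAdj = ¬uw ; related = e ; path = p ▸ q ; perm = ↭-refl
                        ; fewer = s≤s (≤-reflexive (nonEdges-++ w xs v ys u)) }
  ... | yes uw = record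
    { NonEdge found
    ; perm  = ↭-trans (↭-solve 5 (λ u w v xs ys → (u ⊕ ((w ⊕ xs) ⊕ (v ⊕ ys))) ⊜
        (w ⊕ (xs ⊕ (v ⊕ (ys ⊕ u))))) ↭-refl [ u ] [ w ] [ v ] xs ys) (NonEdge.perm found)
    ; fewer = <-≤-trans (NonEdge.fewer found) (≤-reflexive (cong (nonEdges w xs v +_)
        (trans (nonEdges-++ v ys u [] w) (trans (cong (nonEdges v ys u +_) (cost-edge uw))
          (+-identityʳ _))))) }
    where found = findNonEdge p (q ▸ edge e) 0<

  findNonEdgeInCycle : ∀ {u w xs} → Path R u (w ∷ xs) u → 0 < nonEdges u (w ∷ xs) u →
                       NonEdge (u ∷ w ∷ xs) (nonEdges u (w ∷ xs) u)
  findNonEdgeInCycle {u} {w} {xs} (e ∷ p) 0< with adj? u w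
  ... | no ¬uw = record { nonAdj = ¬uw ; related = e ; path = p ; perm = ↭-refl ; fewer = ≤-refl }
  ... | yes uw = record
    { NonEdge found
    ; perm  = ↭-trans (↭-solve 3 (λ u w xs → (u ⊕ (w ⊕ xs)) ⊜ (w ⊕ (xs ⊕ u)))
        ↭-refl [ u ] [ w ] xs) (NonEdge.perm found)
    ; fewer = <-≤-trans (NonEdge.fewer found) (≤-reflexive
        (trans (cong (nonEdges w xs u +_) (cost-edge uw)) (+-identityʳ _))) }
    where found = findNonEdge p (edge e) 0<

  module _ {a b : Fin n} {zs : List (Fin n)} (nonAdj : ¬ Adj a b) (n≤ : n ≤ degree a + degree b)
    (p : Path R b zs a) (unique : Unique (a ∷ b ∷ zs))
    -- The cycle has `suc (length zs)` vertices besides its start, and `nonEdges b zs a` leaves out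
    -- `ab`. So `stuck` excludes a cycle at least as long with strictly fewer non-edges.
    (stuck : ∀ {u xs} → Path R u xs u → Unique (u ∷ xs) → length zs < length xs →
             nonEdges u xs u ≤ nonEdges b zs a → ⊥) where

    private
      rest : List (Fin n)
      rest = complement (a ∷ b ∷ zs)

    noCommon : ∀ {z} → z ∈ rest → ¬ (Adj a z × Adj b z)
    noCommon {z} z∈ (az , bz) = stuck (Adj⇒R az ∷ Adj⇒R (adj-sym bz) ∷ p)
      (unique-↭ (↭-solve 4 (λ z a b zs → (z ⊕ (a ⊕ (b ⊕ zs))) ⊜ (a ⊕ (z ⊕ (b ⊕ zs))))
        ↭-refl [ z ] [ a ] [ b ] zs)
        (unique-∷ (proj₂ (∈-filter⁻ (_∉? (a ∷ b ∷ zs)) {xs = allFin n} z∈)) unique))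
      (s≤s (n≤1+n _))
      (≤-reflexive (cong₂ (λ i j → i + (j + nonEdges b zs a)) (cost-edge az)
        (cost-edge (adj-sym bz))))

    -- The edges `ac` and `bd` would replace the pairs `ab` and `cd`: from `b` along `ys` to `c`,
    -- over to `a`, through `xs` reversed to `d`, and back to `b`. No vertex is lost.
    noCrossing : ∀ {ys c d xs} → zs ≡ ys ++ c ∷ d ∷ xs → ¬ (Adj a c × Adj b d)
    noCrossing {ys} {c} {d} {xs} refl (ac , bd) with splitPath ys p
    ... | q , e ∷ r = stuck
      (q ▸ Adj⇒R (adj-sym ac) ∷ (reversePath R-sym r ▸ edge (Adj⇒R (adj-sym bd))))
      (unique-↭ (↭-trans
        (++⁺ʳ (a ∷ b ∷ ys ++ c ∷ d ∷ []) (↭-sym (↭-reverse xs)))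
        (↭-solve 6 (λ a b c d ys xs → (xs ⊕ (a ⊕ (b ⊕ (ys ⊕ (c ⊕ d))))) ⊜
          (b ⊕ (ys ⊕ (c ⊕ (a ⊕ (xs ⊕ d)))))) ↭-refl [ a ] [ b ] [ c ] [ d ] ys (reverse xs)))
        (unique-↭ (↭-solve 6 (λ a b c d ys xs → (a ⊕ (b ⊕ (ys ⊕ (c ⊕ (d ⊕ xs))))) ⊜
          (xs ⊕ (a ⊕ (b ⊕ (ys ⊕ (c ⊕ d)))))) ↭-refl [ a ] [ b ] [ c ] [ d ] ys xs) unique))
      (≤-reflexive lengths)
      costs
      where
      lengths : suc (length (ys ++ c ∷ d ∷ xs)) ≡ length (ys ++ c ∷ a ∷ reverse xs ++ d ∷ [])
      lengths rewrite length-++ ys {c ∷ d ∷ xs} | length-++ ys {c ∷ a ∷ reverse xs ++ d ∷ []}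
        | length-++ (reverse xs) {d ∷ []} | length-reverse xs = lemma (length ys) (length xs)
        where
        lemma : ∀ y x → suc (y + suc (suc x)) ≡ y + suc (suc (x + 1))
        lemma = solve-∀
      costs : nonEdges b (ys ++ c ∷ a ∷ reverse xs ++ d ∷ []) b ≤ nonEdges b (ys ++ c ∷ d ∷ xs) a
      costs rewrite nonEdges-++ b ys c (a ∷ reverse xs ++ d ∷ []) b | nonEdges-++ b ys c (d ∷ xs) a
        | nonEdges-++ a (reverse xs) d [] b | nonEdges-reverse d xs a
        | cost-edge (adj-sym ac) | cost-edge (adj-sym bd) | +-identityʳ (nonEdges d xs a)
        = +-monoʳ-≤ (nonEdges b ys c) (m≤n+m _ _)

    degree-outside : ∀ v → ¬ Adj v a → ¬ Adj v b →
                     degree v ≡ count (adj? v) zs + count (adj? v) rest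
    degree-outside v ¬va ¬vb = trans (degree-split G v unique)
      (cong (_+ count (adj? v) rest)
        (trans (count-reject (adj? v) {a} {b ∷ zs} ¬va) (count-reject (adj? v) {b} {zs} ¬vb)))

    -- The neighbour counts of `a` and `b` add up to at most `suc (length zs)` on `zs` and at most
    -- `length rest` off the cycle, while `a` and `b` themselves contribute nothing. The total is at
    -- most `n - 1`.
    crossing-⊥ : ⊥
    crossing-⊥ = <⇒≱ sum<n n≤
      where
      lemma : ∀ p q r s → (p + q) + (r + s) ≡ (p + r) + (q + s)
      lemma = solve-∀
      sum<n : degree a + degree b < n
      sum<n = begin-strict
        degree a + degree b
          ≡⟨ cong₂ _+_ (degree-outside a (adj-irrefl refl) nonAdj)
                       (degree-outside b (nonAdj ∘ adj-sym) (adj-irrefl refl)) ⟩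
        (count (adj? a) zs + count (adj? a) rest) + (count (adj? b) zs + count (adj? b) rest)
          ≡⟨ lemma (count (adj? a) zs) _ _ _ ⟩
        (count (adj? a) zs + count (adj? b) zs) + (count (adj? a) rest + count (adj? b) rest)
          ≤⟨ +-mono-≤ (count-noncrossing (adj? a) (adj? b) zs noCrossing)
                      (count-disjoint (adj? a) (adj? b) rest noCommon) ⟩
        suc (length zs) + length rest
          <⟨ n<1+n _ ⟩
        suc (suc (length zs)) + length rest
          ≡⟨ unique-length unique ⟩
        n ∎
        where open ≤-Reasoning

  -- An `R`-cycle longer than `c` is exchanged for ones with fewer and fewer non-edges, none of them
  -- shorter, until a cycle of `G` longer than `c` results.
  oreCycle-bound : ∀ {c} → (∀ {u xs} → Path Adj u xs u → Unique (u ∷ xs) → 2 ≤ length xs →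
                            length xs ≤ c) →
                   ∀ {u xs} → Path R u xs u → Unique (u ∷ xs) → 2 ≤ length xs → length xs ≤ c
  oreCycle-bound {c} longest {u} {xs} p un 2≤ = ≮⇒≥ λ c< → go (suc (nonEdges u xs u)) p un 2≤ c< ≤-refl
    where
    go : ∀ k {u xs} → Path R u xs u → Unique (u ∷ xs) → 2 ≤ length xs → c < length xs →
         nonEdges u xs u < k → ⊥
    go (suc k) {u} {x ∷ xs} p un 2≤ c< (s≤s m≤k) with nonEdges u (x ∷ xs) u in eq
    ... | zero  = <⇒≱ c< (longest (noNonEdges p eq) un 2≤)
    ... | suc m = [ nonAdj , (λ n≤ → crossing-⊥ nonAdj n≤ path (unique-↭ perm un) λ q un′ len≤ few →
        go k q un′ (≤-trans 2≤ (longer len≤)) (<-≤-trans c< (longer len≤))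
          (≤-trans (s≤s few) (≤-trans (<-≤-trans fewer (≤-reflexive eq)) m≤k))) ]′ (R⇒Ore related)
      where
      open NonEdge (findNonEdgeInCycle p (subst (0 <_) (sym eq) (s≤s z≤n)))
      longer : ∀ {l} → length zs < l → length (x ∷ xs) ≤ l
      longer len≤ = ≤-trans (≤-reflexive (cong pred (↭-length perm))) len≤

-- Ears through a vertex of a 2-connected graph.

module _ {n} (G : Graph n) where

  open Graph G

  record Ear (vs : List (Fin n)) (x : Fin n) : Set where
    field
      {u v}   : Fin n
      {as bs} : List (Fin n)
      u∈      : u ∈ vs
      v∈      : v ∈ vs
      u≢v     : u ≢ v
      left    : Path Adj u as x
      right   : Path Adj x bs v
      unique  : Unique (x ∷ as ++ bs ++ vs)

    -- `x` is left out: the ear has `suc size` interior vertices.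
    size : ℕ
    size = length as + length bs

  size-≤ : ∀ {vs x} (e : Ear vs x) → Ear.size e ≤ n
  size-≤ {vs} e = ≤-trans
    (≤-trans (+-monoʳ-≤ (length as) (m≤m+n (length bs) (length vs)))
      (≤-trans (≤-reflexive (sym (trans (length-++ as) (cong (length as +_) (length-++ bs))))) (n≤1+n _)))
    (unique-length-≤ unique)
    where open Ear e

  reverse-unique : ∀ xs {ys : List (Fin n)} → Unique (xs ++ ys) → Unique (reverse xs ++ ys)
  reverse-unique xs = unique-↭ (++⁺ʳ _ (↭-sym (↭-reverse xs)))

  flip : ∀ {vs x} → Ear vs x → Ear vs x
  flip {vs} {x} e = record
    { u∈ = v∈ ; v∈ = u∈ ; u≢v = ≢-sym u≢v
    ; left = reversePath adj-sym right ; right = reversePath adj-sym left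
    ; unique = unique-↭ (↭-solve 4 (λ x as bs vs → (as ⊕ (bs ⊕ (x ⊕ vs))) ⊜ (x ⊕ (bs ⊕ (as ⊕ vs))))
        ↭-refl [ x ] (reverse as) (reverse bs) vs)
        (reverse-unique as (unique-↭ (↭-solve 4 (λ x as bs vs →
          (bs ⊕ (x ⊕ (as ⊕ vs))) ⊜ (as ⊕ (bs ⊕ (x ⊕ vs)))) ↭-refl [ x ] as (reverse bs) vs)
        (reverse-unique bs (unique-↭ (↭-solve 4 (λ x as bs vs →
          (x ⊕ (as ⊕ (bs ⊕ vs))) ⊜ (bs ⊕ (x ⊕ (as ⊕ vs)))) ↭-refl [ x ] as bs vs) unique)))) }
    where open Ear e

  -- The walk is cut at its first vertex in `zs`, and loops are erased from the back: if `y` already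
  -- lies on the path found from `y′`, everything before `y` is dropped.
  reach : ∀ {x y u zs} → Unique (x ∷ zs) → y ∉ x ∷ zs → Star (AdjAvoiding ⁅ x ⁆) y u → u ∈ zs →
          ∃₂ λ w ys → w ∈ zs × Path Adj y ys w × Unique (y ∷ ys ++ x ∷ zs)
  reach un y∉ ε u∈ = ⊥-elim (y∉ (there u∈))
  reach {x} {y} {u} {zs} un y∉ (_◅_ {j = y′} (yy′ , _ , y′∉x) s) u∈ with y′ ∈? zs
  ... | yes y′∈ = y′ , [] , y′∈ , edge yy′ , unique-∷ y∉ un
  ... | no  y′∉ with reach un y′∉∷ s u∈
    where
    y′∉∷ : y′ ∉ x ∷ zs
    y′∉∷ (here refl) = x∉⁅y⁆⇒x≢y y′∉x refl
    y′∉∷ (there y′∈) = y′∉ y′∈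
  ...   | w , ys , w∈ , p , un′ with y ∈? (y′ ∷ ys)
  ...     | yes (here refl) = w , ys , w∈ , p , un′
  ...     | no y∉ys = w , y′ ∷ ys , w∈ , yy′ ∷ p , unique-∷ y∉all un′
    where
    y∉all : y ∉ (y′ ∷ ys) ++ x ∷ zs
    y∉all y∈ with ∈-++⁻ (y′ ∷ ys) y∈
    ... | inj₁ y∈ys = y∉ys y∈ys
    ... | inj₂ y∈zs = y∉ y∈zs
  ...     | yes (there y∈) with ∈-∃++ y∈
  ...       | ys₁ , ys₂ , refl = w , ys₂ , w∈ , proj₂ (splitPath ys₁ p) ,
    unique-sub (y′ ∷ ys₁) (↭-solve 5 (λ y′ y ys₁ ys₂ zs →
      (y′ ⊕ ((ys₁ ⊕ (y ⊕ ys₂)) ⊕ zs)) ⊜ ((y ⊕ (ys₂ ⊕ zs)) ⊕ (y′ ⊕ ys₁)))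
      ↭-refl [ y′ ] [ y ] ys₁ ys₂ (x ∷ zs)) un′

  module _ (connected : 2 -Connected G) where

    avoiding : ∀ x {u v} → u ≢ x → v ≢ x → Star (AdjAvoiding ⁅ x ⁆) u v
    avoiding x u≢ v≢ = proj₂ connected ⁅ x ⁆ (≤-reflexive (cong suc (∣⁅x⁆∣≡1 x)))
      (x≢y⇒x∉⁅y⁆ u≢) (x≢y⇒x∉⁅y⁆ v≢)

    module _ {vs : List (Fin n)} (other : ∀ y → ∃ λ z → z ∈ vs × z ≢ y) where

      private
        -- The new ear follows the old one from `u` to `w`, takes `ms` backwards to `x`, steps to
        -- `x′` and keeps the right half. The part of `as` beyond `w` is given up.
        reroute : ∀ {x x′ w ms} (e : Ear vs x′) → Adj x x′ → w ∈ Ear.u e ∷ Ear.as e → Path Adj x ms w →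
                  Unique (x ∷ ms ++ x′ ∷ Ear.as e ++ Ear.bs e ++ vs) → Ear vs x
        reroute {x} {x′} {w} {ms} e xx′ w∈ p un with redirect (Ear.left e) w∈
        ... | ys , zs , refl , _ , f = record
          { u∈ = u∈ ; v∈ = v∈ ; u≢v = u≢v
          ; left = f (reversePath adj-sym p)
          ; right = xx′ ∷ right
          ; unique = unique-↭ (↭-solve 6 (λ ms x x′ ys bs vs → (ms ⊕ (x ⊕ (x′ ⊕ (ys ⊕ (bs ⊕ vs))))) ⊜
              (x ⊕ ((ys ⊕ ms) ⊕ ((x′ ⊕ bs) ⊕ vs)))) ↭-refl (reverse ms) [ x ] [ x′ ] ys bs vs)
              (reverse-unique ms (unique-sub zs (↭-solve 7 (λ ms x x′ ys bs vs zs →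
              (x ⊕ (ms ⊕ (x′ ⊕ ((ys ⊕ zs) ⊕ (bs ⊕ vs))))) ⊜
              ((ms ⊕ (x ⊕ (x′ ⊕ (ys ⊕ (bs ⊕ vs))))) ⊕ zs)) ↭-refl ms [ x ] [ x′ ] ys bs vs zs) un)) }
          where open Ear e

        -- The same path, split at `x` instead of `x′`.
        shorten : ∀ {x x′} (e : Ear vs x′) → x ∈ Ear.as e → Ear vs x
        shorten {x} {x′} e x∈ with ∈-∃++ x∈
        ... | as₁ , as₂ , eq = record
          { u∈ = u∈ ; v∈ = v∈ ; u≢v = u≢v
          ; left = proj₁ halves
          ; right = proj₂ halves ▸ right
          ; unique = unique-↭ (↭-solve 6 (λ x x′ as₁ as₂ bs vs →
              (x′ ⊕ ((as₁ ⊕ (x ⊕ as₂)) ⊕ (bs ⊕ vs))) ⊜ (x ⊕ (as₁ ⊕ ((as₂ ⊕ (x′ ⊕ bs)) ⊕ vs))))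
              ↭-refl [ x ] [ x′ ] as₁ as₂ bs vs)
              (subst (λ xs → Unique (x′ ∷ xs ++ bs ++ vs)) eq unique) }
          where
          open Ear e
          halves : Path Adj u as₁ x × Path Adj x as₂ x′
          halves = splitPath as₁ (subst (λ xs → Path Adj u xs x′) eq left)

      -- The fan lemma for two paths, by induction along a walk from `x` to `vs`. If the next vertex
      -- `x′` is in `vs`, a path from `x` to `vs` that avoids `x′` is the other half. Otherwise
      -- there is an ear through `x′`; if it misses `x`, a path from `x` that avoids `x′` and ends
      -- on the ear or in `vs` turns it into an ear through `x`.
      ear : ∀ {X x u} → Unique vs → Star (AdjAvoiding X) x u → u ∈ vs → x ∉ vs → Ear vs x
      ear un ε u∈ x∉ = ⊥-elim (x∉ u∈)
      ear {X} {x} un (_◅_ {j = x′} (xx′ , _) s) u∈ x∉ with x′ ∈? vs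
      ... | yes x′∈ with ∈-∃++ x′∈ | other x′
      ...   | vs₁ , vs₂ , refl | z , z∈ , z≢ =
        let w , ms , w∈ , p , un′ = reach (unique-↭ vs↭ un) (x∉ ∘ ∈-resp-↭ (↭-sym vs↭))
                                      (avoiding x′ (λ { refl → x∉ x′∈ }) z≢) z∈vs′
        in record
          { u∈ = x′∈ ; v∈ = ∈-resp-↭ (↭-sym vs↭) (there w∈)
          ; u≢v = λ eq → Unique[x∷xs]⇒x∉xs (unique-↭ vs↭ un) (subst (_∈ _) (sym eq) w∈)
          ; left = edge (adj-sym xx′) ; right = p
          ; unique = unique-↭ (prep x (++⁺ˡ ms (↭-sym vs↭))) un′ }
        where
        vs↭ = shift x′ vs₁ vs₂
        z∈vs′ : z ∈ vs₁ ++ vs₂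
        z∈vs′ with ∈-resp-↭ vs↭ z∈
        ... | here eq = ⊥-elim (z≢ eq)
        ... | there i = i
      ear {X} {x} un (_◅_ {j = x′} (xx′ , _) s) u∈ x∉ | no x′∉ = go (ear un s u∈ x′∉)
        where
        go : Ear vs x′ → Ear vs x
        go e with x ∈? Ear.as e | x ∈? Ear.bs e
        ... | yes x∈ | _ = shorten e x∈
        ... | no _ | yes x∈ = shorten (flip e) (∈-resp-↭ (↭-sym (↭-reverse _)) x∈)
        ... | no x∉as | no x∉bs = continue
          (reach unique x∉all (avoiding x′ x≢x′ u≢x′) (∈-++⁺ʳ as (∈-++⁺ʳ bs u∈′)))
          where
          open Ear e renaming (u∈ to u∈′)
          x≢x′ : x ≢ x′
          x≢x′ refl = adj-irrefl refl xx′
          u≢x′ : u ≢ x′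
          u≢x′ refl = x′∉ u∈′
          x∉all : x ∉ x′ ∷ as ++ bs ++ vs
          x∉all (here eq) = x≢x′ eq
          x∉all (there x∈) with ∈-++⁻ as x∈
          ... | inj₁ i = x∉as i
          ... | inj₂ j with ∈-++⁻ bs j
          ...   | inj₁ i = x∉bs i
          ...   | inj₂ k = x∉ k
          flipped : ∀ {ms} → Unique (x ∷ ms ++ x′ ∷ as ++ bs ++ vs) →
                    Unique (x ∷ ms ++ x′ ∷ reverse bs ++ reverse as ++ vs)
          flipped {ms} un = unique-↭ (prep x (++⁺ˡ ms (prep x′ (↭-trans (↭-solve 3 (λ as bs vs →
            (as ⊕ (bs ⊕ vs)) ⊜ (bs ⊕ (as ⊕ vs))) ↭-refl as bs vs)
            (↭-++⁺ (↭-sym (↭-reverse bs)) (++⁺ʳ vs (↭-sym (↭-reverse as)))))))) un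
          continue : (∃₂ λ w ms → w ∈ as ++ bs ++ vs × Path Adj x ms w ×
                      Unique (x ∷ ms ++ x′ ∷ as ++ bs ++ vs)) → Ear vs x
          -- A path that returns to `u` must keep `v` as the other end; one that ends elsewhere in
          -- `vs` replaces `v` by its own end.
          continue (w , ms , w∈ , p , un) with w ≟ u | ∈-++⁻ as w∈
          ... | yes refl | _ = reroute e xx′ (here refl) p un
          ... | no _ | inj₁ w∈as = reroute e xx′ (there w∈as) p un
          ... | no w≢u | inj₂ w∈′ with ∈-++⁻ bs w∈′
          ...   | inj₁ w∈bs = reroute (flip e) xx′
                  (there (∈-resp-↭ (↭-sym (↭-reverse bs)) w∈bs)) p (flipped un)
          ...   | inj₂ w∈vs = record
            { u∈ = u∈′ ; v∈ = w∈vs ; u≢v = ≢-sym w≢u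
            ; left = left ▸ edge (adj-sym xx′) ; right = p
            ; unique = unique-sub bs (↭-solve 6 (λ x x′ ms as bs vs →
                (x ⊕ (ms ⊕ (x′ ⊕ (as ⊕ (bs ⊕ vs))))) ⊜ ((x ⊕ ((as ⊕ x′) ⊕ (ms ⊕ vs))) ⊕ bs))
                ↭-refl [ x ] [ x′ ] ms as bs vs) un }

unique-⊆-length : ∀ {A : Set} {xs ys : List A} → Unique xs → (∀ {z} → z ∈ xs → z ∈ ys) →
                  length xs ≤ length ys
unique-⊆-length {xs = []}     _         _  = z≤n
unique-⊆-length {xs = x ∷ xs} un@(_ ∷ u) xs⊆ with ∈-∃++ (xs⊆ (here refl))
... | ys₁ , ys₂ , refl = ≤-trans (s≤s (unique-⊆-length u λ z∈ →
    drop z∈ (∈-resp-↭ (shift x ys₁ ys₂) (xs⊆ (there z∈)))))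
  (≤-reflexive (sym (↭-length (shift x ys₁ ys₂))))
  where
  drop : ∀ {z} → z ∈ xs → z ∈ x ∷ ys₁ ++ ys₂ → z ∈ ys₁ ++ ys₂
  drop z∈ (here refl) = ⊥-elim (Unique[x∷xs]⇒x∉xs un z∈)
  drop z∈ (there i)   = i

++-cancel-length : ∀ {A : Set} (zs : List A) {xs ys} → length (zs ++ xs) ≤ length (zs ++ ys) →
                   length xs ≤ length ys
++-cancel-length []       le = le
++-cancel-length (z ∷ zs) le = ++-cancel-length zs (≤-pred le)

clique-path : ∀ {A : Set} {R : A → A → Set} {xs u v} → AllPairs R (u ∷ xs ∷ʳ v) → Path R u xs v
clique-path = linked⇒path _ ∘ AllPairs⇒Linked

-- The two arcs have `l₁` and `l₂` inner vertices, of which `e₁` and `e₂` are neighbours of `x`.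
-- Neighbours among the two ends, on the two halves of the ear and among the `ρ` remaining vertices
-- number `d`, `dA`, `dB` and `σ`; `r` is the size of the ear. The last hypothesis is
-- `n ≤ 2 * degree x`.
surplus-arithmetic : ∀ {e₁ e₂ l₁ l₂ d dA dB t r ρ σ} →
  2 * e₁ + suc r ≤ l₁ → 2 * e₂ + suc r ≤ l₂ → d ≤ 2 → dA + dB + t ≤ r → σ ≤ ρ →
  suc r + (2 + (l₁ + l₂)) + ρ ≤ 2 * ((dA + (dB + (d + (e₁ + e₂)))) + σ) →
  suc r + 2 * t ≤ σ
surplus-arithmetic {e₁} {e₂} {l₁} {l₂} {d} {dA} {dB} {t} {r} {ρ} {σ} h₁ h₂ h₃ h₄ h₅ h₆ =
  cancel-≤ (2 * (e₁ + e₂ + r + 2 + d + dA + dB) + σ + l₁ + l₂ + ρ)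
    (+-mono-≤ h₁ (+-mono-≤ h₂ (+-mono-≤ (*-monoʳ-≤ 2 h₃) (+-mono-≤ (*-monoʳ-≤ 2 h₄) (+-mono-≤ h₅ h₆)))))
    (lhs e₁ e₂ l₁ l₂ d dA dB t r ρ σ) (rhs e₁ e₂ l₁ l₂ d dA dB r ρ σ)
  where
  lhs : ∀ e₁ e₂ l₁ l₂ d dA dB t r ρ σ →
    (2 * e₁ + suc r) + ((2 * e₂ + suc r) + (2 * d + (2 * (dA + dB + t) +
      (σ + (suc r + (2 + (l₁ + l₂)) + ρ))))) ≡
    2 * (e₁ + e₂ + r + 2 + d + dA + dB) + σ + l₁ + l₂ + ρ + (suc r + 2 * t)
  lhs = solve-∀
  rhs : ∀ e₁ e₂ l₁ l₂ d dA dB r ρ σ →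
    l₁ + (l₂ + (2 * 2 + (2 * r + (ρ + 2 * ((dA + (dB + (d + (e₁ + e₂)))) + σ))))) ≡
    2 * (e₁ + e₂ + r + 2 + d + dA + dB) + σ + l₁ + l₂ + ρ + σ
  rhs = solve-∀

-- Neighbours of a heavy vertex off a longest cycle.

module OffLongestCycle {n} (G : Graph n) (connected : 2 -Connected G)
  {c₀ : Fin n} {cs : List (Fin n)} (cycle : Path (Graph.Adj G) c₀ cs c₀) (cycle-unique : Unique (c₀ ∷ cs))
  (2≤cs : 2 ≤ length cs)
  (longest : ∀ {u xs} → Path (Graph.Adj G) u xs u → Unique (u ∷ xs) → 2 ≤ length xs →
             length xs ≤ length cs)
  {x : Fin n} (x∉ : x ∉ c₀ ∷ cs) (heavy : Graph.Heavy G x)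
  (no-star : ∀ {a b c d} → All (Graph.Adj G x) (a ∷ b ∷ c ∷ d ∷ []) →
             AllPairs (λ u v → u ≢ v × ¬ Graph.Adj G u v) (a ∷ b ∷ c ∷ d ∷ []) → ⊥)
  where

  open Graph G
  open Counting (adj? x)

  vs : List (Fin n)
  vs = c₀ ∷ cs

  rotate : ∀ {u} → u ∈ vs → ∃ λ ms → Path Adj u ms u × vs ↭ u ∷ ms
  rotate (here refl) = cs , cycle , ↭-refl
  rotate {u} (there u∈) with ∈-∃++ u∈
  ... | ys , zs , refl with splitPath ys cycle
  ...   | p , q = zs ++ c₀ ∷ ys , q ▸ p ,
    ↭-solve 4 (λ c u ys zs → (c ⊕ (ys ⊕ (u ⊕ zs))) ⊜ (u ⊕ (zs ⊕ (c ⊕ ys)))) ↭-refl [ c₀ ] [ u ] ys zs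

  record Arcs (u v : Fin n) : Set where
    field
      {ls ms} : List (Fin n)
      out     : Path Adj u ls v
      back    : Path Adj v ms u
      perm    : vs ↭ u ∷ ls ++ v ∷ ms

  arcs : ∀ {u v} → u ∈ vs → v ∈ vs → u ≢ v → Arcs u v
  arcs u∈ v∈ u≢v with rotate u∈
  ... | ms , p , perm with ∈-resp-↭ perm v∈
  ...   | here eq  = ⊥-elim (u≢v (sym eq))
  ...   | there v∈ with ∈-∃++ v∈
  ...     | ys , zs , refl =
    record { out = proj₁ (splitPath ys p) ; back = proj₂ (splitPath ys p) ; perm = perm }

  opposite : ∀ {u v} → Arcs u v → Arcs v u
  opposite {u} {v} arc = record { out = back ; back = out ; perm = ↭-trans perm
    (↭-solve 4 (λ u v ls ms → (u ⊕ (ls ⊕ (v ⊕ ms))) ⊜ (v ⊕ (ms ⊕ (u ⊕ ls)))) ↭-refl [ u ] [ v ] ls ms) }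
    where open Arcs arc

  -- Exchanging the arc for the detour gives a cycle, so it cannot gain vertices. The empty detour
  -- is set apart because it could leave fewer than three vertices.
  detour-≤ : ∀ {u v es} (arc : Arcs u v) → Path Adj u es v → Unique (es ++ vs) →
             length es ≤ length (Arcs.ls arc)
  detour-≤ {es = []}     _   _ _  = z≤n
  detour-≤ {u} {v} {es = e ∷ es} arc p un = cancel-≤ (suc (length ms))
    (longest (p ▸ back) (unique-sub ls (↭-trans (++⁺ˡ (e ∷ es) perm)
        (↭-solve 5 (λ es u ls v ms → (es ⊕ (u ⊕ (ls ⊕ (v ⊕ ms)))) ⊜ ((u ⊕ (es ⊕ (v ⊕ ms))) ⊕ ls))
          ↭-refl (e ∷ es) [ u ] ls [ v ] ms)) un)
      (s≤s (≤-trans (s≤s z≤n) (≤-trans (m≤n+m (suc (length ms)) (length es))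
        (≤-reflexive (sym (length-++ es)))))))
    (trans (length-++ (e ∷ es)) (+-comm (length (e ∷ es)) _))
    (trans (cong pred (↭-length perm)) (trans (length-++ ls) (+-comm (length ls) _)))
    where open Arcs arc

  -- From a neighbour of `x` on the arc, detours through `x` and either half of the ear lead to `u`
  -- and to `v`, which keeps it away from both ends. Without such a neighbour the whole ear is a
  -- detour.
  arc-count : (e : Ear G vs x) (arc : Arcs (Ear.u e) (Ear.v e)) →
              2 * count (Arcs.ls arc) + suc (Ear.size e) ≤ length (Arcs.ls arc)
  arc-count e arc with count-sparse (suc (length as)) (suc (length bs)) ls sparse
    where
    open Ear e
    open Arcs arc
    sparse : Sparse (suc (length as)) (suc (length bs)) ls
    sparse {ys} {z} {zs} refl xz with splitPath ys out
    ... | p , q = before , after , separate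
      where
      before : suc (length as) ≤ length ys
      before = ≤-trans (≤-reflexive (trans (+-comm 1 (length as)) (sym (length-++ as)))) (detour-≤
        (record { out = p ; back = q ▸ back ; perm = ↭-trans perm
          (↭-solve 6 (λ u v z ys zs ms → (u ⊕ ((ys ⊕ (z ⊕ zs)) ⊕ (v ⊕ ms))) ⊜
            (u ⊕ (ys ⊕ (z ⊕ (zs ⊕ (v ⊕ ms)))))) ↭-refl [ u ] [ v ] [ z ] ys zs ms) })
        (left ▸ edge xz)
        (unique-sub bs (↭-solve 4 (λ x as bs vs → (x ⊕ (as ⊕ (bs ⊕ vs))) ⊜ (((as ⊕ x) ⊕ vs) ⊕ bs))
          ↭-refl [ x ] as bs vs) unique))
      after : suc (length bs) ≤ length zs
      after = detour-≤
        (record { out = q ; back = back ▸ p ; perm = ↭-trans perm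
          (↭-solve 6 (λ u v z ys zs ms → (u ⊕ ((ys ⊕ (z ⊕ zs)) ⊕ (v ⊕ ms))) ⊜
            (z ⊕ (zs ⊕ (v ⊕ (ms ⊕ (u ⊕ ys)))))) ↭-refl [ u ] [ v ] [ z ] ys zs ms) })
        (adj-sym xz ∷ right)
        (unique-sub as (↭-solve 4 (λ x as bs vs → (x ⊕ (as ⊕ (bs ⊕ vs))) ⊜ (((x ⊕ bs) ⊕ vs) ⊕ as))
          ↭-refl [ x ] as bs vs) unique)
      separate : ∀ {z′ zs′} → zs ≡ z′ ∷ zs′ → ¬ Adj x z′
      -- The arc from `z` to `z′` is empty, while the detour contains `x`.
      separate {z′} {zs′} refl xz′ = n≮0 (detour-≤
        (record { out = proj₁ (splitPath [] q) ; back = proj₂ (splitPath [] q) ▸ (back ▸ p)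
                ; perm = ↭-trans perm
          (↭-solve 7 (λ u v z z′ ys zs ms → (u ⊕ ((ys ⊕ (z ⊕ (z′ ⊕ zs))) ⊕ (v ⊕ ms))) ⊜
            (z ⊕ (z′ ⊕ (zs ⊕ (v ⊕ (ms ⊕ (u ⊕ ys))))))) ↭-refl [ u ] [ v ] [ z ] [ z′ ] ys zs′ ms) })
        (adj-sym xz ∷ edge xz′) (unique-∷ x∉ cycle-unique))
  ... | inj₁ none rewrite none = ≤-trans (≤-reflexive (sym (trans (length-++ as) (+-suc _ _))))
        (detour-≤ arc (left ▸ right) (unique-↭ (↭-solve 4 (λ x as bs vs →
          (x ⊕ (as ⊕ (bs ⊕ vs))) ⊜ ((as ⊕ (x ⊕ bs)) ⊕ vs)) ↭-refl [ x ] as bs vs) unique))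
    where
    open Ear e
  ... | inj₂ le = ≤-pred (≤-trans (≤-reflexive (lemma (count ls) (length as) (length bs))) le)
    where
    open Ear e
    open Arcs arc
    lemma : ∀ c a b → suc (2 * c + suc (a + b)) ≡ 2 * c + suc (a + suc b)
    lemma = solve-∀

  size-flip : (e : Ear G vs x) → Ear.size (flip G e) ≡ Ear.size e
  size-flip e = trans (cong₂ _+_ (length-reverse (Ear.bs e)) (length-reverse (Ear.as e)))
                      (+-comm (length (Ear.bs e)) _)

  outside : Ear G vs x → List (Fin n)
  outside e = filter (adj? x) (complement (x ∷ as ++ bs ++ vs))
    where open Ear e

  -- `t` is at most the number of vertices of the ear, other than `x`, not adjacent to `x`. Each of
  -- these lowers twice the degree by two, hence `2 * t`.
  surplus : ∀ (e : Ear G vs x) {t} → count (Ear.as e) + count (Ear.bs e) + t ≤ Ear.size e →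
            suc (Ear.size e) + 2 * t ≤ length (outside e)
  surplus e {t} le = surplus-arithmetic
    {e₁ = count ls} {e₂ = count ms} {dA = count as} {dB = count bs} {t = t}
    (arc-count e arc)
    (subst (λ s → 2 * count ms + suc s ≤ length ms) (size-flip e) (arc-count (flip G e) (opposite arc)))
    (count-≤ (u ∷ v ∷ [])) le (count-≤ free)
    (≤-trans (≤-reflexive vertices) (≤-trans heavy (≤-reflexive (cong (2 *_) degrees))))
    where
    open Ear e
    arc = arcs u∈ v∈ u≢v
    open Arcs arc
    free = complement (x ∷ as ++ bs ++ vs)
    vs↭ : vs ↭ (u ∷ v ∷ []) ++ ls ++ ms
    vs↭ = ↭-trans perm (↭-solve 4 (λ u v ls ms → (u ⊕ (ls ⊕ (v ⊕ ms))) ⊜ ((u ⊕ v) ⊕ (ls ⊕ ms)))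
      ↭-refl [ u ] [ v ] ls ms)
    vertices : suc (length as + length bs) + (2 + (length ls + length ms)) + length free ≡ n
    vertices = trans (cong (_+ length free) (cong suc (trans (+-assoc (length as) _ _)
      (sym (trans (length-++ as) (cong (length as +_) (trans (length-++ bs) (cong (length bs +_)
        (trans (↭-length vs↭) (cong (2 +_) (length-++ ls))))))))))) (unique-length unique)
    degrees : degree x ≡ (count as + (count bs + (count (u ∷ v ∷ []) + (count ls + count ms)))) + count free
    degrees = trans (degree-split G x unique) (cong (_+ count free)
      (trans (count-reject {x} {as ++ bs ++ vs} (adj-irrefl refl)) (trans (count-++ as _) (cong (count as +_)
        (trans (count-++ bs _) (cong (count bs +_) (trans (count-↭ vs↭)
          (trans (count-++ (u ∷ v ∷ []) _) (cong (count (u ∷ v ∷ []) +_) (count-++ ls ms))))))))))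

  -- Longest ears and their exits.

  LongestEar : Ear G vs x → Set
  LongestEar e = ∀ (e′ : Ear G vs x) → Ear.size e′ ≤ Ear.size e

  record Exit (e : Ear G vs x) : Set where
    open Ear e using (as; bs)
    field
      {w}      : Fin n
      {ys}     : List (Fin n)
      w∈       : w ∈ as ++ bs ++ vs
      nonempty : 0 < length ys
      path     : Path Adj x ys w
      unique   : Unique (ys ++ x ∷ as ++ bs ++ vs)

    size : ℕ
    size = length ys

  exit-size-≤ : ∀ {e} (ex : Exit e) → Exit.size ex ≤ n
  exit-size-≤ ex = unique-length-≤ (unique-++⁻ˡ (Exit.ys ex) (Exit.unique ex))

  -- Rerouting the ear through an exit that returns to its left half loses the part zs of as behind w;
  -- with a bypass of x, even the neighbours of x within zs can be reached, so they come late in zs.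
  left-exit : ∀ (e : Ear G vs x) → LongestEar e → ∀ {w ys} →
    w ∈ Ear.u e ∷ Ear.as e → Path Adj x ys w → Unique (ys ++ x ∷ Ear.as e ++ Ear.bs e ++ vs) →
    length ys ≤ length (Ear.as e) ×
    (Path Adj (Ear.u e) (Ear.as e ++ Ear.bs e) (Ear.v e) →
      count (Ear.as e) + length ys ≤ length (Ear.as e))
  left-exit record { u = u ; v = v ; bs = bs ; u∈ = u∈ ; v∈ = v∈ ; u≢v = u≢v ; left = left ; right = right }
    max {w} {ys} w∈ p un with redirect left w∈
  ... | ks , zs , refl , _ , f = ys≤zs , λ through → ≤-trans
    (≤-reflexive (trans (cong (_+ length ys) (count-++ ks zs)) (+-assoc (count ks) _ _)))
    (≤-trans (+-mono-≤ (count-≤ ks) (count-delay (length ys) zs (delay through) ys≤zs′))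
      (≤-reflexive (sym (length-++ ks))))
    where
    detour : Path Adj u (ks ++ reverse ys) x
    detour = f (reversePath adj-sym p)
    ys≤zs′ : length ys ≤ length zs
    ys≤zs′ = ≤-trans (≤-reflexive (sym (length-reverse ys))) (++-cancel-length ks
      (+-cancelʳ-≤ (length bs) _ _ (max (record
        { u∈ = u∈ ; v∈ = v∈ ; u≢v = u≢v ; left = detour ; right = right
        ; unique = unique-sub zs (↭-solve 6 (λ ys x ks zs bs vs →
            (ys ⊕ (x ⊕ ((ks ⊕ zs) ⊕ (bs ⊕ vs)))) ⊜ ((x ⊕ ((ks ⊕ ys) ⊕ (bs ⊕ vs))) ⊕ zs))
            ↭-refl (reverse ys) [ x ] ks zs bs vs) (reverse-unique G ys un) }))))
    ys≤zs : length ys ≤ length (ks ++ zs)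
    ys≤zs = ≤-trans ys≤zs′ (≤-trans (m≤n+m _ _) (≤-reflexive (sym (length-++ ks))))
    -- The new ear steps from `x` to `z` and follows the bypass through `gs` and `bs` to `v`, so
    -- that only `fs` is traded for `ys`.
    delay : Path Adj u ((ks ++ zs) ++ bs) v → ∀ {fs z gs} → zs ≡ fs ++ z ∷ gs → Adj x z →
            length ys ≤ length fs
    delay through {fs} {z} {gs} refl xz = cancel-≤ (length ks + suc (length gs + length bs))
      (max (record
        { u∈ = u∈ ; v∈ = v∈ ; u≢v = u≢v ; left = detour
        ; right = xz ∷ proj₂ (splitPath (ks ++ fs) (subst (λ xs → Path Adj u xs v) regroup through))
        ; unique = unique-sub fs (↭-solve 8 (λ ys x ks fs z gs bs vs →
            (ys ⊕ (x ⊕ ((ks ⊕ (fs ⊕ (z ⊕ gs))) ⊕ (bs ⊕ vs)))) ⊜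
            ((x ⊕ ((ks ⊕ ys) ⊕ ((z ⊕ (gs ⊕ bs)) ⊕ vs))) ⊕ fs))
            ↭-refl (reverse ys) [ x ] ks fs [ z ] gs bs vs) (reverse-unique G ys un) }))
      new old
      where
      regroup : (ks ++ fs ++ z ∷ gs) ++ bs ≡ (ks ++ fs) ++ z ∷ gs ++ bs
      regroup = trans (cong (_++ bs) (sym (++-assoc ks fs (z ∷ gs)))) (++-assoc (ks ++ fs) (z ∷ gs) bs)
      new : length (ks ++ reverse ys) + length (z ∷ gs ++ bs) ≡
            length ks + suc (length gs + length bs) + length ys
      new rewrite length-++ ks {reverse ys} | length-reverse ys | length-++ gs {bs} =
        lemma (length ks) (length ys) (length gs) (length bs)
        where
        lemma : ∀ k y g b → k + y + suc (g + b) ≡ k + suc (g + b) + y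
        lemma = solve-∀
      old : length (ks ++ fs ++ z ∷ gs) + length bs ≡
            length ks + suc (length gs + length bs) + length fs
      old rewrite length-++ ks {fs ++ z ∷ gs} | length-++ fs {z ∷ gs} =
        lemma (length ks) (length fs) (length gs) (length bs)
        where
        lemma : ∀ k f g b → k + (f + suc g) + b ≡ k + suc (g + b) + f
        lemma = solve-∀

  module MaximalEar (e : Ear G vs x) (max : LongestEar e) where

    open Ear e

    S : List (Fin n)
    S = outside e

    S-adj : ∀ {y} → y ∈ S → Adj x y
    S-adj = proj₂ ∘ ∈-filter⁻ (adj? x) {xs = complement _}

    S-outside : ∀ {y} → y ∈ S → y ∉ x ∷ as ++ bs ++ vs
    S-outside = proj₂ ∘ ∈-filter⁻ (_∉? (x ∷ as ++ bs ++ vs)) {xs = allFin n} ∘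
                proj₁ ∘ ∈-filter⁻ (adj? x) {xs = complement _}

    ∈-S : ∀ {y} → Adj x y → y ∉ x ∷ as ++ bs ++ vs → y ∈ S
    ∈-S xy y∉ = ∈-filter⁺ (adj? x) (∈-filter⁺ (_∉? _) (∈-allFin _) y∉) xy

    S-unique : Unique S
    S-unique = filter⁺ (adj? x) (filter⁺ (_∉? (x ∷ as ++ bs ++ vs)) (allFin⁺ n))

    size<S : suc size ≤ length S
    size<S = ≤-trans (m≤m+n _ _) (surplus e {0}
      (≤-trans (≤-reflexive (+-identityʳ _)) (+-mono-≤ (count-≤ as) (count-≤ bs))))

    u≢x : u ≢ x
    u≢x eq = x∉ (subst (_∈ vs) eq u∈)

    p q : Fin n
    p = proj₁ (lastEdge left)
    q = proj₁ (firstEdge right)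

    p∈ : p ∈ u ∷ as
    p∈ = proj₁ (proj₂ (lastEdge left))

    q∈ : q ∈ v ∷ bs
    q∈ = proj₁ (proj₂ (firstEdge right))

    px : Adj p x
    px = proj₁ (proj₂ (proj₂ (lastEdge left)))

    xq : Adj x q
    xq = proj₁ (proj₂ (proj₂ (firstEdge right)))

    bypass : Adj p q → Path Adj u (as ++ bs) v
    bypass pq = proj₂ (proj₂ (proj₂ (lastEdge left))) (proj₂ (proj₂ (proj₂ (firstEdge right))) pq)

    p∈ear : p ∈ as ++ bs ++ vs
    p∈ear with p∈
    ... | here eq = ∈-++⁺ʳ as (∈-++⁺ʳ bs (subst (_∈ vs) (sym eq) u∈))
    ... | there i   = ∈-++⁺ˡ i

    q∈ear : q ∈ as ++ bs ++ vs
    q∈ear with q∈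
    ... | here eq = ∈-++⁺ʳ as (∈-++⁺ʳ bs (subst (_∈ vs) (sym eq) v∈))
    ... | there i   = ∈-++⁺ʳ as (∈-++⁺ˡ i)

    p≢q : p ≢ q
    p≢q p≡q with as-unique | p∈ | q∈
      where
      as-unique : Unique (as ++ bs ++ vs)
      as-unique = unique-sub [ x ]
        (↭-solve 2 (λ x as → (x ⊕ as) ⊜ (as ⊕ x)) ↭-refl [ x ] (as ++ bs ++ vs)) unique
    ... | un | here eq | here eq′ = u≢v (trans (sym eq) (trans p≡q eq′))
    ... | un | there i | here eq =
      unique-++⁻-disjoint as un i (∈-++⁺ʳ bs (subst (_∈ vs) (sym (trans p≡q eq)) v∈))
    ... | un | there i | there j = unique-++⁻-disjoint as un i (∈-++⁺ˡ (subst (_∈ bs) (sym p≡q) j))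
    ... | un | here eq | there j = unique-++⁻-disjoint bs
      (unique-sub as (↭-solve 2 (λ as xs → (as ⊕ xs) ⊜ (xs ⊕ as)) ↭-refl as (bs ++ vs)) un)
      j (subst (_∈ vs) (trans (sym eq) p≡q) u∈)

    ear≢S : ∀ {w y} → w ∈ as ++ bs ++ vs → y ∈ S → w ≢ y
    ear≢S w∈ y∈ refl = S-outside y∈ (there w∈)

    -- Otherwise `y` fits between `p` and `x`, which lengthens the ear.
    p≁S : ∀ {y} → y ∈ S → ¬ Adj p y
    p≁S {y} y∈ py = n≮n _ (≤-trans (≤-reflexive longer) (max (record
      { u∈ = u∈ ; v∈ = v∈ ; u≢v = u≢v ; right = right
      ; left = proj₂ (proj₂ (proj₂ (lastEdge left))) (py ∷ edge (adj-sym (S-adj y∈)))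
      ; unique = unique-↭ (↭-solve 4 (λ y x as zs → (y ⊕ (x ⊕ (as ⊕ zs))) ⊜ (x ⊕ ((as ⊕ y) ⊕ zs)))
          ↭-refl [ y ] [ x ] as (bs ++ vs)) (unique-∷ (S-outside y∈) unique) })))
      where
      longer : suc size ≡ length (as ++ [ y ]) + length bs
      longer = cong (_+ length bs) (trans (+-comm 1 (length as)) (sym (length-++ as)))

    q≁S : ∀ {y} → y ∈ S → ¬ Adj q y
    q≁S {y} y∈ qy = n≮n _ (≤-trans (≤-reflexive (sym (+-suc (length as) _))) (max (record
      { u∈ = u∈ ; v∈ = v∈ ; u≢v = u≢v ; left = left
      ; right = S-adj y∈ ∷ proj₂ (proj₂ (proj₂ (firstEdge right))) (adj-sym qy)
      ; unique = unique-↭ (↭-solve 5 (λ y x as bs vs → (y ⊕ (x ⊕ (as ⊕ (bs ⊕ vs)))) ⊜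
            (x ⊕ (as ⊕ ((y ⊕ bs) ⊕ vs))))
          ↭-refl [ y ] [ x ] as bs vs) (unique-∷ (S-outside y∈) unique) })))

    -- `size<S` provides a member of `S`, and from it a path avoiding `x` returns to the ear or the
    -- cycle.
    exit : Exit e
    exit =
      let y , y∈ = nonempty-∈ (≤-trans (s≤s z≤n) size<S)
          w , ys , w∈ , r , un = reach G unique (S-outside y∈)
            (avoiding G connected x (S-outside y∈ ∘ here) u≢x) (∈-++⁺ʳ as (∈-++⁺ʳ bs u∈))
      in record { w∈ = w∈ ; nonempty = s≤s z≤n ; path = S-adj y∈ ∷ r ; unique = un }

    -- Outer neighbours and a longest exit.

    module MaximalExit {w y : Fin n} {ys : List (Fin n)} (w∈ : w ∈ as ++ bs ++ vs) (xy : Adj x y) (path : Path Adj y ys w)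
      (exit-unique : Unique (y ∷ ys ++ x ∷ as ++ bs ++ vs))
      (max-exit : ∀ (ex : Exit e) → Exit.size ex ≤ suc (length ys)) where

      y∈S : y ∈ S
      y∈S = ∈-S xy λ y∈ → unique-++⁻-disjoint (y ∷ ys) exit-unique (here refl) y∈

      fresh : ∀ {z} → z ∈ S → z ∉ y ∷ ys → z ∉ (y ∷ ys) ++ x ∷ as ++ bs ++ vs
      fresh z∈ z∉ i with ∈-++⁻ (y ∷ ys) i
      ... | inj₁ j = z∉ j
      ... | inj₂ j = S-outside z∈ j

      -- Otherwise `z` can be put in front of `y`, which lengthens the exit.
      y≁S : ∀ {z} → z ∈ S → z ∉ y ∷ ys → ¬ Adj y z
      y≁S z∈ z∉ yz = n≮n _ (max-exit (record { w∈ = w∈ ; nonempty = s≤s z≤n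
        ; path = S-adj z∈ ∷ adj-sym yz ∷ path ; unique = unique-∷ (fresh z∈ z∉) exit-unique }))

      -- A member of `S` missed by the exit would be independent of `p`, `q` and `y`, giving four
      -- independent neighbours of `x`.
      S-≤ : ¬ Adj p q → length S ≤ suc (length ys)
      S-≤ p≁q = unique-⊆-length S-unique on-exit
        where
        on-exit : ∀ {z} → z ∈ S → z ∈ y ∷ ys
        on-exit {z} z∈ with z ∈? (y ∷ ys)
        ... | yes i = i
        ... | no z∉ = ⊥-elim (no-star (adj-sym px ∷ xq ∷ xy ∷ S-adj z∈ ∷ [])
          (((p≢q , p≁q) ∷ (ear≢S p∈ear y∈S , p≁S y∈S) ∷ (ear≢S p∈ear z∈ , p≁S z∈) ∷ []) ∷
           ((ear≢S q∈ear y∈S , q≁S y∈S) ∷ (ear≢S q∈ear z∈ , q≁S z∈) ∷ []) ∷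
           ((z∉ ∘ here ∘ sym , y≁S z∈ z∉) ∷ []) ∷ [] ∷ []))

      S′ : List (Fin n)
      S′ = filter (_∉? (y ∷ ys)) S

      S′⊆ : ∀ {z} → z ∈ S′ → z ∈ S × z ∉ y ∷ ys
      S′⊆ = ∈-filter⁻ (_∉? (y ∷ ys)) {xs = S}

      S′-unique : Unique S′
      S′-unique = filter⁺ (_∉? (y ∷ ys)) S-unique

      -- The four independent neighbours would now be `p`, `y`, `z` and `z′`; so this holds even if
      -- `p` and `q` are adjacent.
      S′-adj : ∀ {z z′} → z ∈ S′ → z′ ∈ S′ → z ≢ z′ → Adj z z′
      S′-adj {z} {z′} z∈ z′∈ z≢z′ with adj? z z′
      ... | yes zz′ = zz′
      ... | no z≁z′ = let z∈S , z∉ = S′⊆ z∈ ; z′∈S , z′∉ = S′⊆ z′∈ in ⊥-elim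
        (no-star (adj-sym px ∷ xy ∷ S-adj z∈S ∷ S-adj z′∈S ∷ [])
          (((ear≢S p∈ear y∈S , p≁S y∈S) ∷ (ear≢S p∈ear z∈S , p≁S z∈S) ∷ (ear≢S p∈ear z′∈S , p≁S z′∈S) ∷ []) ∷
           ((z∉ ∘ here ∘ sym , y≁S z∈S z∉) ∷ (z′∉ ∘ here ∘ sym , y≁S z′∈S z′∉) ∷ []) ∷
           ((z≢z′ , z≁z′) ∷ []) ∷ [] ∷ []))

      clique : ∀ {zs} → Unique zs → (∀ {z} → z ∈ zs → z ∈ S′) → AllPairs Adj zs
      clique {[]}     _         _   = []
      clique {z ∷ zs} (px ∷ un) zs⊆ =
        All.tabulate (λ z′∈ → S′-adj (zs⊆ (here refl)) (zs⊆ (there z′∈)) (All.lookup px z′∈)) ∷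
        clique un (zs⊆ ∘ there)

      -- As S′ is a clique of neighbours of x, a path leaving it for good at z extends backwards
      -- through all of S′ to x.
      sweep : ∀ {z zs w′} → z ∈ S′ → w′ ∈ (y ∷ ys) ++ as ++ bs ++ vs → Path Adj z zs w′ →
        All (_∉ S′) zs → Unique (zs ++ x ∷ (y ∷ ys) ++ as ++ bs ++ vs) → length S′ ≤ suc (length ys)
      sweep {z} {zs} {w′} z∈ w′∈ r zs∉ un with ∈-∃++ z∈
      ... | fs , gs , eq = go (∈-++⁻ (y ∷ ys) w′∈)
        where
        S′↭ : S′ ↭ (fs ++ gs) ++ [ z ]
        S′↭ = ↭-trans (↭-reflexive eq)
          (↭-solve 3 (λ fs z gs → (fs ⊕ (z ⊕ gs)) ⊜ ((fs ⊕ gs) ⊕ z)) ↭-refl fs [ z ] gs)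
        through : Path Adj x (fs ++ gs) z
        through = clique-path
          (All.tabulate (λ i → S-adj (proj₁ (S′⊆ (∈-resp-↭ (↭-sym S′↭) i)))) ∷
           clique (unique-↭ S′↭ S′-unique) (∈-resp-↭ (↭-sym S′↭)))
        all-unique : Unique (S′ ++ zs ++ x ∷ (y ∷ ys) ++ as ++ bs ++ vs)
        all-unique = unique-++⁺ S′-unique un λ (i , j) → apart i (∈-++⁻ zs j)
          where
          apart : ∀ {t} → t ∈ S′ → t ∈ zs ⊎ t ∈ x ∷ (y ∷ ys) ++ as ++ bs ++ vs → ⊥
          apart i (inj₁ j) = All.lookup zs∉ j i
          apart i (inj₂ (here refl)) = S-outside (proj₁ (S′⊆ i)) (here refl)
          apart i (inj₂ (there j)) with ∈-++⁻ (y ∷ ys) j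
          ... | inj₁ k = proj₂ (S′⊆ i) k
          ... | inj₂ k = S-outside (proj₁ (S′⊆ i)) (there k)
        S′-≤ : ∀ ts → length S′ ≤ length ((fs ++ gs) ++ z ∷ ts)
        S′-≤ ts = ≤-trans (≤-reflexive (↭-length S′↭)) (≤-trans (m≤m+n _ (length ts))
          (≤-reflexive (trans (sym (length-++ ((fs ++ gs) ++ [ z ])))
            (cong length (++-assoc (fs ++ gs) [ z ] ts)))))
        0<S′ : 0 < length S′
        0<S′ = subst (0 <_) (sym (trans (↭-length S′↭) (trans (length-++ (fs ++ gs)) (+-comm _ 1)))) (s≤s z≤n)
        go : w′ ∈ y ∷ ys ⊎ w′ ∈ as ++ bs ++ vs → length S′ ≤ suc (length ys)
        go (inj₂ w′∈ear) = ≤-trans (S′-≤ zs) (max-exit (record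
          { w∈ = w′∈ear ; nonempty = <-≤-trans 0<S′ (S′-≤ zs) ; path = through ▸ r
          ; unique = unique-sub (y ∷ ys) (↭-trans (++⁺ʳ _ S′↭) (↭-solve 6 (λ fg z zs x ys es →
              ((fg ⊕ z) ⊕ (zs ⊕ (x ⊕ (ys ⊕ es)))) ⊜ (((fg ⊕ (z ⊕ zs)) ⊕ (x ⊕ es)) ⊕ ys)) ↭-refl
              (fs ++ gs) [ z ] zs [ x ] (y ∷ ys) (as ++ bs ++ vs))) all-unique }))
        -- A path that ends on the old exit continues along it to `w`, losing only the part `ys₁`
        -- before `w′`.
        go (inj₁ w′∈ys) with suffixFrom w′∈ys
          where
          suffixFrom : ∀ {w′} → w′ ∈ y ∷ ys → ∃₂ λ ys₁ ys₂ → y ∷ ys ≡ ys₁ ++ w′ ∷ ys₂ × Path Adj w′ ys₂ _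
          suffixFrom w′∈ys with ∈-∃++ w′∈ys
          ... | ys₁ , ys₂ , eq = ys₁ , ys₂ , eq ,
            proj₂ (splitPath ys₁ (subst (λ ts → Path Adj x ts _) eq (xy ∷ path)))
        ... | ys₁ , ys₂ , eq , r′ = ≤-trans (S′-≤ (zs ++ w′ ∷ ys₂)) (max-exit (record
          { w∈ = w∈ ; nonempty = <-≤-trans 0<S′ (S′-≤ _) ; path = through ▸ (r ▸ r′)
          ; unique = unique-sub ys₁ (↭-trans
              (↭-++⁺ S′↭ (++⁺ˡ zs (prep x (++⁺ʳ (as ++ bs ++ vs) (↭-reflexive eq)))))
              (↭-solve 8 (λ fg z zs x ys₁ w′ ys₂ es →
              ((fg ⊕ z) ⊕ (zs ⊕ (x ⊕ ((ys₁ ⊕ (w′ ⊕ ys₂)) ⊕ es)))) ⊜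
              (((fg ⊕ (z ⊕ (zs ⊕ (w′ ⊕ ys₂)))) ⊕ (x ⊕ es)) ⊕ ys₁)) ↭-refl
              (fs ++ gs) [ z ] zs [ x ] ys₁ [ w′ ] ys₂ (as ++ bs ++ vs))) all-unique }))

      -- A path avoiding `x` leads from a member of `S′` to the exit, the ear or the cycle. It is
      -- cut at its last vertex in `S′`, as `sweep` requires.
      S′-≤ : length S′ ≤ suc (length ys)
      S′-≤ with S′ in eq
      ... | [] = z≤n
      ... | z ∷ _ = subst (λ xs → length xs ≤ suc (length ys)) eq bound
        where
        z∈ : z ∈ S′
        z∈ = subst (z ∈_) (sym eq) (here refl)
        z∈S = proj₁ (S′⊆ z∈)
        z∉ : z ∉ x ∷ (y ∷ ys) ++ as ++ bs ++ vs
        z∉ (here refl) = S-outside z∈S (here refl)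
        z∉ (there i) with ∈-++⁻ (y ∷ ys) i
        ... | inj₁ j = proj₂ (S′⊆ z∈) j
        ... | inj₂ j = S-outside z∈S (there j)
        bound : length S′ ≤ suc (length ys)
        bound with reach G (unique-↭ (↭-solve 3 (λ ys x es → (ys ⊕ (x ⊕ es)) ⊜ (x ⊕ (ys ⊕ es))) ↭-refl
                     (y ∷ ys) [ x ] (as ++ bs ++ vs)) exit-unique) z∉
                     (avoiding G connected x (z∉ ∘ here) u≢x)
                     (∈-++⁺ʳ (y ∷ ys) (∈-++⁺ʳ as (∈-++⁺ʳ bs u∈)))
        ... | w′ , ms , w′∈ , r , un with lastVisit (_∈? S′) z∈ r
        ...   | z′ , ms′ , ts , z′∈ , eq′ , r′ , ms′∉ = sweep z′∈ w′∈ r′ ms′∉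
          (unique-sub (ts ++ [ z′ ]) (↭-trans (++⁺ʳ _ (↭-reflexive eq′))
            (↭-solve 4 (λ ts z ms xs → ((ts ⊕ (z ⊕ ms)) ⊕ xs) ⊜ ((ms ⊕ xs) ⊕ (ts ⊕ z))) ↭-refl
              ts [ z′ ] ms′ (x ∷ (y ∷ ys) ++ as ++ bs ++ vs))) un)

      S-≤2 : length S ≤ 2 * suc (length ys)
      S-≤2 = ≤-trans (unique-⊆-length {ys = y ∷ ys ++ S′} S-unique cover)
        (≤-trans (≤-reflexive (cong suc (length-++ ys)))
          (+-monoʳ-≤ (suc (length ys)) (≤-trans S′-≤ (≤-reflexive (sym (+-identityʳ _))))))
        where
        cover : ∀ {z} → z ∈ S → z ∈ (y ∷ ys) ++ S′
        cover {z} z∈ with z ∈? (y ∷ ys)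
        ... | yes i = ∈-++⁺ˡ i
        ... | no z∉ = ∈-++⁺ʳ (y ∷ ys) (∈-filter⁺ (_∉? (y ∷ ys)) z∈ z∉)

      private
        t : ℕ
        t = suc (length ys)

      -- For exits that end on the ear. If `p` and `q` are not adjacent, `size < length S ≤ t`;
      -- otherwise `surplus` exceeds the bound `2 * t` by `suc size`.
      half-⊥ : t ≤ size → (Adj p q → count as + count bs + t ≤ size) → ⊥
      half-⊥ t≤ improved with adj? p q
      ... | no p≁q = n≮n _ (≤-trans size<S (≤-trans (S-≤ p≁q) t≤))
      ... | yes pq = m+1+n≰m (2 * t)
        (≤-trans (≤-reflexive (+-comm (2 * t) _)) (≤-trans (surplus e (improved pq)) S-≤2))

      ear-exit-⊥ : ⊥
      -- `u` and `v` go with the halves of the ear, since an exit to either of them can replace only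
      -- one half.
      ear-exit-⊥ with w ∈? (u ∷ as) | w ∈? (v ∷ bs)
      ... | yes w∈as | _ = let t≤ , improved = left-exit e max w∈as (xy ∷ path) exit-unique in
        half-⊥ (≤-trans t≤ (m≤m+n _ _)) λ pq → ≤-trans
          (≤-reflexive (lemma (count as) (count bs) t)) (+-mono-≤ (improved (bypass pq)) (count-≤ bs))
        where
        lemma : ∀ a b t → a + b + t ≡ a + t + b
        lemma = solve-∀
      ... | no _ | yes w∈bs =
        let t≤ , improved = left-exit (flip G e) (λ e′ → ≤-trans (max e′) (≤-reflexive (sym (size-flip e))))
              (flipped w∈bs) (xy ∷ path)
              (unique-↭ (++⁺ˡ (y ∷ ys) (prep x (↭-trans (↭-solve 3 (λ as bs vs →
                (as ⊕ (bs ⊕ vs)) ⊜ (bs ⊕ (as ⊕ vs))) ↭-refl as bs vs)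
                (↭-++⁺ (↭-sym (↭-reverse bs)) (++⁺ʳ vs (↭-sym (↭-reverse as))))))) exit-unique)
        in half-⊥ (≤-trans t≤ (≤-trans (≤-reflexive (length-reverse bs)) (m≤n+m _ _))) λ pq →
          ≤-trans (≤-reflexive (+-assoc (count as) _ _)) (+-mono-≤ (count-≤ as)
            (subst (λ k → k + t ≤ length bs) (count-↭ (↭-reverse bs))
              (≤-trans (improved (subst (λ xs → Path Adj v xs u) (reverse-++ as bs)
                (reversePath adj-sym (bypass pq)))) (≤-reflexive (length-reverse bs)))))
        where
        flipped : w ∈ v ∷ bs → w ∈ v ∷ reverse bs
        flipped (here eq) = here eq
        flipped (there i) = there (∈-resp-↭ (↭-sym (↭-reverse bs)) i)
      -- `w` is on the cycle and differs from `u` and `v`, so the exit can replace either half. Each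
      -- half has at least `t` inner vertices, whence `length S ≤ 2 * t ≤ size`.
      ... | no w∉as | no w∉bs = n≮n _ (≤-trans size<S (≤-trans S-≤2
          (≤-trans (≤-reflexive (cong (t +_) (+-identityʳ t))) (+-mono-≤ t≤as t≤bs))))
        where
        w∈vs : w ∈ vs
        w∈vs with ∈-++⁻ as w∈
        ... | inj₁ i = ⊥-elim (w∉as (there i))
        ... | inj₂ j with ∈-++⁻ bs j
        ...   | inj₁ i = ⊥-elim (w∉bs (there i))
        ...   | inj₂ k = k
        t≤bs : t ≤ length bs
        t≤bs = +-cancelˡ-≤ (length as) _ _ (max (record
          { u∈ = u∈ ; v∈ = w∈vs ; u≢v = w∉as ∘ here ∘ sym ; left = left ; right = xy ∷ path
          ; unique = unique-sub bs (↭-solve 5 (λ ys x as bs vs → (ys ⊕ (x ⊕ (as ⊕ (bs ⊕ vs)))) ⊜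
              ((x ⊕ (as ⊕ (ys ⊕ vs))) ⊕ bs)) ↭-refl (y ∷ ys) [ x ] as bs vs) exit-unique }))
        t≤as : t ≤ length as
        t≤as = ≤-trans (≤-reflexive (sym (length-reverse (y ∷ ys)))) (+-cancelʳ-≤ (length bs) _ _ (max (record
          { u∈ = w∈vs ; v∈ = v∈ ; u≢v = w∉bs ∘ here
          ; left = reversePath adj-sym (xy ∷ path) ; right = right
          ; unique = unique-sub as (↭-solve 5 (λ ys x as bs vs → (ys ⊕ (x ⊕ (as ⊕ (bs ⊕ vs)))) ⊜
              ((x ⊕ (ys ⊕ (bs ⊕ vs))) ⊕ as)) ↭-refl (reverse (y ∷ ys)) [ x ] as bs vs)
              (reverse-unique G (y ∷ ys) exit-unique) })))

    maximal-ear-⊥ : ⊥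
    maximal-ear-⊥ = ascent Exit.size exit-size-≤ maximal exit
      where
      maximal : ∀ ex → (∀ ex′ → Exit.size ex′ ≤ Exit.size ex) → ⊥
      maximal record { w∈ = w∈ ; path = xy ∷ path ; unique = unique } max-exit =
        MaximalExit.ear-exit-⊥ w∈ xy path unique max-exit

  first-ear : Ear G vs x
  first-ear = ear G connected other cycle-unique
    -- The walk from `x` to `c₀` is taken in the graph without a second cycle vertex.
    (avoiding G connected (proj₁ (other c₀))
      (λ eq → x∉ (subst (_∈ vs) (sym eq) (proj₁ (proj₂ (other c₀)))))
      (≢-sym (proj₂ (proj₂ (other c₀))))) (here refl) x∉
    where
    other : ∀ y → ∃ λ z → z ∈ vs × z ≢ y
    other y with y ≟ c₀
    ... | no y≢    = c₀ , here refl , ≢-sym y≢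
    ... | yes refl = let z , z∈ = nonempty-∈ (≤-trans (s≤s z≤n) 2≤cs) in
      z , there z∈ , λ eq → Unique[x∷xs]⇒x∉xs cycle-unique (subst (_∈ cs) eq z∈)

  longestCycle-⊥ : ⊥
  longestCycle-⊥ = ascent Ear.size (size-≤ G) MaximalEar.maximal-ear-⊥ first-ear

-- Induced stars, the enlarged graph and the theorem.

∈-tabulate-does : ∀ {n} {P : Fin n → Set} (P? : Decidable P) {v} →
  v Subset.∈ Vec.tabulate (does ∘ P?) ⇔ P v
∈-tabulate-does P? {v} = mk⇔ to
  (λ Pv → lookup⇒[]= v _
    (trans (lookup∘tabulate _ v) (dec-true (P? v) Pv)))
  where
  to : v Subset.∈ Vec.tabulate (does ∘ P?) → _
  to v∈ with P? v | trans (sym (lookup∘tabulate (does ∘ P?) v)) ([]=⇒lookup v∈)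
  ... | yes Pv | _  = Pv
  ... | no _   | ()

allPairs-lookup : ∀ {A : Set} {R : A → A → Set} → Symmetric R → ∀ {xs} → AllPairs R xs →
  ∀ {i j} → i ≢ j → R (lookup xs i) (lookup xs j)
allPairs-lookup R-sym (px ∷ ps) {zero}  {zero}  i≢j = ⊥-elim (i≢j refl)
allPairs-lookup R-sym (px ∷ ps) {zero}  {suc j} i≢j = All.lookup px (∈-lookup j)
allPairs-lookup R-sym (px ∷ ps) {suc i} {zero}  i≢j = R-sym (All.lookup px (∈-lookup i))
allPairs-lookup R-sym (px ∷ ps) {suc i} {suc j} i≢j = allPairs-lookup R-sym ps (i≢j ∘ cong suc)

module _ {n} (G : Graph n) where

  open Graph G

  -- The centre is adjacent to every leaf, so the nonadjacent pair that heaviness provides consists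
  -- of leaves.
  heavy-leaves : ∀ {x} ls → (K₁, length ls) -Heavy G → All (Adj x) ls →
    AllPairs (λ u v → u ≢ v × ¬ Adj u v) ls →
    ∃₂ λ i j → i ≢ j × n ≤ degree (lookup ls i) + degree (lookup ls j)
  heavy-leaves {x} ls star-heavy x-ls indep = conclude (star-heavy _ star)
    where
    to : Fin (suc (length ls)) → Fin n
    to zero    = x
    to (suc i) = lookup ls i
    x-leaf : ∀ i → Adj x (lookup ls i)
    x-leaf i = All.lookup x-ls (∈-lookup i)
    independent : ∀ {i j} → i ≢ j → lookup ls i ≢ lookup ls j ×
                  ¬ Adj (lookup ls i) (lookup ls j)
    independent = allPairs-lookup (λ (u≢v , u≁v) → ≢-sym u≢v , u≁v ∘ adj-sym) indep
    injective : ∀ {i j} → to i ≡ to j → i ≡ j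
    injective {zero}  {zero}  _  = refl
    injective {zero}  {suc j} eq = ⊥-elim (adj-irrefl eq (x-leaf j))
    injective {suc i} {zero}  eq = ⊥-elim (adj-irrefl (sym eq) (x-leaf i))
    injective {suc i} {suc j} eq with i ≟ j
    ... | yes refl = refl
    ... | no i≢j   = ⊥-elim (proj₁ (independent i≢j) eq)
    adjacency : ∀ i j → StarAdj i j ⇔ Adj (to i) (to j)
    adjacency zero    zero    = mk⇔ (λ ()) (⊥-elim ∘ adj-irrefl refl)
    adjacency zero    (suc j) = mk⇔ (λ _ → x-leaf j) (λ _ → centre-leaf j)
    adjacency (suc i) zero    = mk⇔ (λ _ → adj-sym (x-leaf i)) (λ _ → leaf-centre i)
    adjacency (suc i) (suc j) = mk⇔ (λ ()) λ ij → case i ≟ j of λ where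
      (yes refl) → ⊥-elim (adj-irrefl refl ij)
      (no i≢j)   → ⊥-elim (proj₂ (independent i≢j) ij)
    star : InducedIso (K₁, length ls) G (Vec.tabulate (λ v → does (any? λ i → to i ≟ v)))
    star = record { to = to ; injective = injective ; adjacency = adjacency
                  ; image = λ v → ∈-tabulate-does (λ v → any? λ i → to i ≟ v) }
    conclude : _ → _
    conclude (u , v , u∈ , v∈ , u≢v , u≁v , n≤)
      with Equivalence.to (InducedIso.image star u) u∈ | Equivalence.to (InducedIso.image star v) v∈
    ... | zero  , refl | zero  , refl = ⊥-elim (u≢v refl)
    ... | zero  , refl | suc j , refl = ⊥-elim (u≁v (x-leaf j))
    ... | suc i , refl | zero  , refl = ⊥-elim (u≁v (adj-sym (x-leaf i)))
    ... | suc i , refl | suc j , refl = i , j , (λ { refl → u≢v refl }) , n≤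

  -- Only G-edges are kept at x, because the leaves of a star centred at x must be neighbours of x in G.
  oreGraph : Fin n → Graph n
  oreGraph x = record
    { Adj = λ u v → Adj u v ⊎ (u ≢ x × v ≢ x × u ≢ v × n ≤ degree u + degree v)
    ; adj? = λ u v → adj? u v ⊎-dec
        (¬? (u ≟ x) ×-dec ¬? (v ≟ x) ×-dec ¬? (u ≟ v) ×-dec (n ≤? degree u + degree v))
    ; adj-sym = λ where
        (inj₁ uv) → inj₁ (adj-sym uv)
        {u} {v} (inj₂ (u≢x , v≢x , u≢v , n≤)) →
          inj₂ (v≢x , u≢x , ≢-sym u≢v , subst (n ≤_) (+-comm (degree u) (degree v)) n≤)
    ; adj-irrefl = λ where
        eq (inj₁ uv) → adj-irrefl eq uv
        eq (inj₂ (_ , _ , u≢v , _)) → u≢v eq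
    }

  module _ {x : Fin n} where

    private
      module H = Graph (oreGraph x)

    oreGraph-adj : ∀ {u} → H.Adj x u → Adj x u
    oreGraph-adj (inj₁ xu)        = xu
    oreGraph-adj (inj₂ (x≢x , _)) = ⊥-elim (x≢x refl)

    -- No edge is added at `x`; hence `x` remains heavy.
    oreGraph-degree : H.degree x ≡ degree x
    oreGraph-degree = trans (degree-count (oreGraph x) x)
      (trans (cong length (filter-≐ (H.adj? x) (adj? x) (oreGraph-adj , inj₁) (allFin n)))
        (sym (degree-count G x)))

    oreGraph-connected : ∀ {k} → k -Connected G → k -Connected oreGraph x
    oreGraph-connected (k<n , conn) = k<n , λ X ∣X∣<k u∉ v∉ →
      gmap id (λ (uv , ends) → inj₁ uv , ends) (conn X ∣X∣<k u∉ v∉)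

    -- Two of the leaves would have degree sum at least `n`, and `oreGraph x` joins such a pair.
    oreGraph-no-star : ∀ ls → (K₁, length ls) -Heavy G → All (H.Adj x) ls →
      ¬ AllPairs (λ u v → u ≢ v × ¬ H.Adj u v) ls
    oreGraph-no-star ls star-heavy x-ls indep =
      let i , j , i≢j , n≤ = heavy-leaves ls star-heavy (All.map oreGraph-adj x-ls)
                               (AllPairs.map (λ (u≢v , u≁v) → u≢v , u≁v ∘ inj₁) indep)
          u≢v , u≁v = allPairs-lookup (λ (u≢v , u≁v) → ≢-sym u≢v , u≁v ∘ H.adj-sym) indep i≢j
      in u≁v (inj₂ (leaf≢x i , leaf≢x j , u≢v , n≤))
      where
      leaf≢x : ∀ i → lookup ls i ≢ x
      leaf≢x i eq = H.adj-irrefl (sym eq) (All.lookup x-ls (∈-lookup i))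

theorem4 : ∀ {n} (G : Graph n) → 2 -Connected G → (K₁, 4) -Heavy G →
    (C : Cycle G) → Longest C → HeavyCycle C
theorem4 {n} G connected star-heavy C longest x heavy with x ∈? Cycle.vertices C
... | yes x∈ = x∈
... | no  x∉ = ⊥-elim (OffLongestCycle.longestCycle-⊥ (oreGraph G x) (oreGraph-connected G connected)
  (mapPath inj₁ (linked⇒path rest linked)) unique (≤-pred 3≤length)
  -- The added edges create no cycle longer than `C`.
  (OreCycle.oreCycle-bound G H.Adj H.adj-sym inj₁ ore λ p un 2≤ → ≤-pred (longest (record
    { unique = un ; linked = path⇒linked p ; 3≤length = s≤s 2≤ })))
  x∉ (subst (λ d → n ≤ 2 * d) (sym (oreGraph-degree G)) heavy)
  (oreGraph-no-star G _ star-heavy))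
  where
  open Cycle C
  module H = Graph (oreGraph G x)
  ore : ∀ {u v} → H.Adj u v → Graph.Adj G u v ⊎ n ≤ Graph.degree G u + Graph.degree G v
  ore (inj₁ uv)               = inj₁ uv
  ore (inj₂ (_ , _ , _ , n≤)) = inj₂ n≤
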